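{- For every odd integer $t\ge 17$, $$2t-1\le \operatorname{DS}(3,t)\le 5t-10.$$
   Context: Graphs are finite and simple. A graph is $R(s,t)$-good if it contains neither a clique of order $s$ nor an independent set of order $t$. It is doubly saturated $R(s,t)$-good if it is $R(s,t)$-good, adding any missing edge destroys that property, and deleting any existing edge also destroys that property. $\operatorname{DS}(s,t)$ denotes the minimum order (number of vertices) of a doubly saturated $R(s,t)$-good graph, when one exists.
   Formalization: The minimum defining DS(3,t) is taken over graphs with at least two vertices; the graphs on zero or one vertex are vacuously doubly saturated and would otherwise make the lower bound false. -}

module Defs where

open import Data.Fin using (Fin; _≟_)
open import Data.Fin.Subset using (Subset; _∈_; ∣_∣)
open import Data.Nat using (ℕ; _≤_)
open import Data.Product using (Σ; ∃; _×_; _,_; swap)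
open import Data.Sum as Sum using (_⊎_; inj₁; inj₂)
open import Level using (0ℓ; suc)
open import Relation.Binary using (Rel; Decidable; Symmetric; Irreflexive)
open import Relation.Binary.PropositionalEquality using (_≡_; _≢_; refl; sym; trans)
open import Relation.Nullary using (¬_; ¬?; _×-dec_; _⊎-dec_)

-- Adjacency is required to be decidable so that, constructively, a finite graph
-- is the same finite amount of data as it is classically.
record Graph (n : ℕ) : Set (suc 0ℓ) where
  field
    _~_      : Rel (Fin n) 0ℓ
    _~?_     : Decidable _~_
    ~-sym    : Symmetric _~_
    ~-irrefl : Irreflexive _≡_ _~_

-- {x , y} and {u , v} are the same unordered pair.
SamePair : ∀ {n} → Fin n → Fin n → Rel (Fin n) 0ℓ
SamePair u v x y = (x ≡ u × y ≡ v) ⊎ (x ≡ v × y ≡ u)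

samePair? : ∀ {n} (u v : Fin n) → Decidable (SamePair u v)
samePair? u v x y = ((x ≟ u) ×-dec (y ≟ v)) ⊎-dec ((x ≟ v) ×-dec (y ≟ u))

samePair-sym : ∀ {n} (u v : Fin n) → Symmetric (SamePair u v)
samePair-sym u v (inj₁ p) = inj₂ (swap p)
samePair-sym u v (inj₂ p) = inj₁ (swap p)

samePair-irrefl : ∀ {n} {u v : Fin n} → u ≢ v → Irreflexive _≡_ (SamePair u v)
samePair-irrefl u≢v refl (inj₁ (x≡u , x≡v)) = u≢v (trans (sym x≡u) x≡v)
samePair-irrefl u≢v refl (inj₂ (x≡v , x≡u)) = u≢v (trans (sym x≡u) x≡v)

addEdge : ∀ {n} (G : Graph n) (u v : Fin n) → u ≢ v → Graph n
addEdge G u v u≢v = record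
  { _~_      = λ x y → x ~ y ⊎ SamePair u v x y
  ; _~?_     = λ x y → (x ~? y) ⊎-dec samePair? u v x y
  ; ~-sym    = Sum.map ~-sym (samePair-sym u v)
  ; ~-irrefl = λ x≡y → Sum.[ ~-irrefl x≡y , samePair-irrefl u≢v x≡y ]
  }
  where open Graph G

deleteEdge : ∀ {n} (G : Graph n) (u v : Fin n) → Graph n
deleteEdge G u v = record
  { _~_      = λ x y → x ~ y × ¬ SamePair u v x y
  ; _~?_     = λ x y → (x ~? y) ×-dec ¬? (samePair? u v x y)
  ; ~-sym    = λ (x~y , ¬p) → ~-sym x~y , λ p → ¬p (samePair-sym u v p)
  ; ~-irrefl = λ x≡y (x~y , _) → ~-irrefl x≡y x~y
  }
  where open Graph G

IsClique : ∀ {n} → Graph n → Subset n → Set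
IsClique G S = ∀ {x y} → x ∈ S → y ∈ S → x ≢ y → x ~ y
  where open Graph G

IsIndependent : ∀ {n} → Graph n → Subset n → Set
IsIndependent G S = ∀ {x y} → x ∈ S → y ∈ S → ¬ (x ~ y)
  where open Graph G

RamseyGood : ∀ {n} → ℕ → ℕ → Graph n → Set
RamseyGood s t G =
    ¬ (∃ λ S → ∣ S ∣ ≡ s × IsClique G S)
  × ¬ (∃ λ S → ∣ S ∣ ≡ t × IsIndependent G S)

record DoublySaturated {n : ℕ} (s t : ℕ) (G : Graph n) : Set where
  open Graph G
  field
    good        : RamseyGood s t G
    add-breaks  : ∀ {u v} (u≢v : u ≢ v) → ¬ (u ~ v) →
                  ¬ RamseyGood s t (addEdge G u v u≢v)
    del-breaks  : ∀ {u v} → u ~ v → ¬ RamseyGood s t (deleteEdge G u v)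

-- On at most one vertex there is no edge to add or delete, so (for s , t ≥ 2)
-- the graphs of order 0 and 1 satisfy DoublySaturated vacuously.  These
-- degenerate graphs are excluded: otherwise the minimum order would always be 0.
HasDoublySaturated : ℕ → ℕ → ℕ → Set (suc 0ℓ)
HasDoublySaturated s t n = 2 ≤ n × Σ (Graph n) (DoublySaturated s t)

-- DS is a partial function of (s , t), so it is given by its graph:
-- IsDS s t d says that DS(s , t) exists and equals d.
IsDS : ℕ → ℕ → ℕ → Set (suc 0ℓ)
IsDS s t d = HasDoublySaturated s t d × (∀ m → HasDoublySaturated s t m → d ≤ m)

{-# OPTIONS --safe #-}

-- Upper bound.  From a tournament T on m = t ∸ 2 vertices build a graph on V(T) × ℤ/5: join (x , i) to
-- (x , i + 2), and to (y , i + 1) whenever x → y in T.  It is triangle-free, and every edge is critical: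
-- for v → w, the set {v , w} × {i , i + 1} ∪ (V ∖ {v , w}) × {i + 3} has m + 2 elements and spans only the
-- edge from (v , i) to (w , i + 1); for the edge from (v , i) to (v , i + 2) the set
-- ({v} ∪ N⁺(v)) × {i} ∪ {(v , i + 1)} ∪ ({v} ∪ N⁻(v)) × {i + 2} does the same.  The graph is maximal
-- triangle-free as soon as every arc x → y of T has a 2-path x → z → y and every pair of vertices has a
-- common out- or in-neighbour.
--
-- So T only has to satisfy these two conditions and make the independence number m + 1.  Take the quadratic
-- residue tournament on ℤ/11 and append a transitive chain z₁₁ → z₁₂ → ⋯ whose vertices dominate
-- alternately {1,…,5} and {0,…,4} in ℤ/11.  A vertex of T occurs at most twice in an independent set, then
-- in two cyclically consecutive layers, and each of the five pairs of consecutive layers is used by at most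
-- one vertex.  If m ≥ 23, two consecutive vertices of the chain therefore occur at most once each, and
-- deleting them gives the tournament for m ∸ 2; m = 15, 17, 19, 21 are settled by a verified search.
--
-- Lower bound.  A doubly saturated R(3,t)-good graph has diameter 2, and all its edges are critical for the
-- independence number t ∸ 1.  By an exchange argument (Erdős–Gallai, Hajnal) every nonempty independent set S
-- then has more than ∣S∣ neighbours; take ∣S∣ = t ∸ 1.

module Submission where

open import Algebra.Properties.CommutativeSemigroup using (x∙yz≈y∙xz)
open import Data.Bool using (Bool; true; false; _∧_; _∨_; not; if_then_else_; T)
open import Data.Bool.ListAction using (all; any)
open import Data.Bool.Properties using (T?; T-∧; T-∨)
open import Data.Fin as Fin using (Fin; zero; suc; #_; toℕ; fromℕ<; combine; remQuot)
open import Data.Fin.Properties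
  using (any?; all?; pigeonhole; toℕ<n; toℕ-injective; toℕ-fromℕ<; remQuot-combine; combine-remQuot)
open import Data.Fin.Subset
  using (Subset; inside; outside; ⊥; ⊤; _∈_; _∉_; _⊆_; ∣_∣; _∪_; _∩_; _─_; _-_; ⁅_⁆)
open import Data.Fin.Subset.Properties
open import Data.List using (List; []; _∷_; map; length; upTo; applyUpTo; allFin; _ʳ++_)
import Data.List.Properties as List
import Data.List.Membership.Propositional as List
open import Data.List.Membership.Propositional.Properties using (∈-allFin)
open import Data.List.Relation.Binary.Permutation.Propositional as ↭ using (_↭_; ↭-sym; ↭-trans)
open import Data.List.Relation.Binary.Permutation.Propositional.Properties
  using (++↭ʳ++; shift; All-resp-↭; ↭-length) renaming (map⁺ to ↭-map⁺)
open import Data.List.Relation.Unary.All as All using (All; []; _∷_)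
import Data.List.Relation.Unary.All.Properties as All
open import Data.List.Relation.Unary.AllPairs as AllPairs using (AllPairs; []; _∷_)
import Data.List.Relation.Unary.AllPairs.Properties as AllPairs
open import Data.List.Relation.Unary.Any using (here; there; satisfied)
open import Data.List.Relation.Unary.Any.Properties using (any⁻)
open import Data.List.Relation.Unary.Unique.Propositional.Properties using (upTo⁺)
open import Data.Nat hiding (∣_-_∣)
open import Data.Nat.DivMod using (m%n<n)
open import Data.Nat.Induction using (<-rec)
open import Data.Nat.ListAction using (sum)
open import Data.Nat.ListAction.Properties using (sum-↭)
open import Data.Nat.Properties
open import Data.Product as Product using (∃; _×_; _,_; proj₁; proj₂)
open import Data.Sum as Sum using (_⊎_; inj₁; inj₂)
open import Data.Unit using (tt)
open import Data.Vec using (Vec; []; _∷_; here; there; lookup; tabulate; concat; _++_; _[_]≔_)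
open import Data.Vec.Properties
  using ([]≔-minimal; []=⇒lookup; lookup⇒[]=; lookup∘tabulate; lookup-concat; lookup-++ˡ; lookup-++ʳ)
open import Function using (_∘_; Equivalence; case_of_)
open import Relation.Binary using (Rel; Symmetric; tri<; tri≈; tri>)
open import Relation.Binary.PropositionalEquality
open import Relation.Nullary
  using (Dec; yes; no; does; ¬_; ¬?; contradiction; _×-dec_; _⊎-dec_; _→-dec_)
open import Relation.Nullary.Decidable using (map′; toWitness; toWitnessFalse; decidable-stable)
import Relation.Unary as U

open import Defs

-- Subsets, decidability and triangles

private variable n k : ℕ

-- The minimum order has to be exhibited, so it is found by well-founded recursion: either no
-- smaller number satisfies `P`, or the search moves to one. The bound `d ≤ n` carries the order of
-- the constructed graph over to the minimum.
least : ∀ {ℓ} {P : ℕ → Set ℓ} → U.Decidable P → ∀ n → P n →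
        ∃ λ d → (P d × (∀ m → P m → d ≤ m)) × d ≤ n
least {P = P} P? = <-rec _ go
  where
  go : ∀ n → (∀ {m} → m < n → P m → ∃ λ d → (P d × (∀ k → P k → d ≤ k)) × d ≤ m) →
       P n → ∃ λ d → (P d × (∀ m → P m → d ≤ m)) × d ≤ n
  go n rec Pn with anyUpTo? P? n
  ... | no  none = n , (Pn , λ m Pm → ≮⇒≥ λ m<n → none (m , m<n , Pm)) , ≤-refl
  ... | yes (m , m<n , Pm) with d , min , d≤m ← rec m<n Pm = d , min , ≤-trans d≤m (<⇒≤ m<n)

select : ∀ {ℓ} {P : U.Pred (Fin n) ℓ} → U.Decidable P → Subset n
select P? = tabulate (does ∘ P?)

module _ {ℓ} {P : U.Pred (Fin n) ℓ} (P? : U.Decidable P) where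

  ∈-select⁺ : ∀ {x} → P x → x ∈ select P?
  ∈-select⁺ {x} Px = lookup⇒[]= x _ (trans (lookup∘tabulate (does ∘ P?) x) (holds (P? x)))
    where
    holds : (d : Dec (P x)) → does d ≡ true
    holds (yes _)  = refl
    holds (no ¬Px) = contradiction Px ¬Px

  ∈-select⁻ : ∀ {x} → x ∈ select P? → P x
  ∈-select⁻ {x} x∈ = holds (P? x) (trans (sym (lookup∘tabulate (does ∘ P?) x)) ([]=⇒lookup x∈))
    where
    holds : (d : Dec (P x)) → does d ≡ true → P x
    holds (yes Px) _ = Px

∈─⇒∉ : ∀ {x} (p q : Subset n) → x ∈ p ─ q → x ∉ q
∈─⇒∉ (_ ∷ p) (outside ∷ q) here      ()
∈─⇒∉ (_ ∷ p) (_ ∷ q)       (there x) (there y) = ∈─⇒∉ p q x y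

∈-⇒≢ : ∀ {x y} (p : Subset n) → x ∈ p - y → x ≢ y
∈-⇒≢ {y = y} p x∈ refl = ∈─⇒∉ p ⁅ y ⁆ x∈ (x∈⁅x⁆ y)

∣p-x∣ : ∀ {x} {p : Subset n} → x ∈ p → suc ∣ p - x ∣ ≡ ∣ p ∣
∣p-x∣ {p = _ ∷ p}       here       = cong (suc ∘ ∣_∣) (p─⊥≡p p)
∣p-x∣ {p = inside ∷ p}  (there x∈) = cong suc (∣p-x∣ x∈)
∣p-x∣ {p = outside ∷ p} (there x∈) = ∣p-x∣ x∈

∣p∩q∣+∣p─q∣≡∣p∣ : ∀ (p q : Subset n) → ∣ p ∩ q ∣ + ∣ p ─ q ∣ ≡ ∣ p ∣
∣p∩q∣+∣p─q∣≡∣p∣ []            []            = refl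
∣p∩q∣+∣p─q∣≡∣p∣ (inside ∷ p)  (inside ∷ q)  = cong suc (∣p∩q∣+∣p─q∣≡∣p∣ p q)
∣p∩q∣+∣p─q∣≡∣p∣ (inside ∷ p)  (outside ∷ q) = trans (+-suc _ _) (cong suc (∣p∩q∣+∣p─q∣≡∣p∣ p q))
∣p∩q∣+∣p─q∣≡∣p∣ (outside ∷ p) (inside ∷ q)  = ∣p∩q∣+∣p─q∣≡∣p∣ p q
∣p∩q∣+∣p─q∣≡∣p∣ (outside ∷ p) (outside ∷ q) = ∣p∩q∣+∣p─q∣≡∣p∣ p q

disjoint-∣∪∣ : ∀ (p q : Subset n) → (∀ {x} → x ∈ p → x ∉ q) → ∣ p ∪ q ∣ ≡ ∣ p ∣ + ∣ q ∣
disjoint-∣∪∣ []            []            _    = refl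
disjoint-∣∪∣ (inside ∷ p)  (inside ∷ q)  disj = contradiction here (disj here)
disjoint-∣∪∣ (inside ∷ p)  (outside ∷ q) disj = cong suc (disjoint-∣∪∣ p q λ x∈ y∈ → disj (there x∈) (there y∈))
disjoint-∣∪∣ (outside ∷ p) (inside ∷ q)  disj =
  trans (cong suc (disjoint-∣∪∣ p q λ x∈ y∈ → disj (there x∈) (there y∈))) (sym (+-suc _ _))
disjoint-∣∪∣ (outside ∷ p) (outside ∷ q) disj = disjoint-∣∪∣ p q λ x∈ y∈ → disj (there x∈) (there y∈)

subset-of-size : ∀ (p : Subset n) → k ≤ ∣ p ∣ → ∃ λ q → q ⊆ p × ∣ q ∣ ≡ k
subset-of-size {n = n} {k = zero} p             _         = ⊥ , ⊆-min p , ∣⊥∣≡0 n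
subset-of-size {k = suc k} (inside ∷ p)  (s≤s k≤) with q , q⊆p , eq ← subset-of-size p k≤ =
  inside ∷ q , s⊆s q⊆p , cong suc eq
subset-of-size {k = suc k} (outside ∷ p) k≤       with q , q⊆p , eq ← subset-of-size p k≤ =
  outside ∷ q , s⊆s q⊆p , eq

nonempty : ∀ (p : Subset n) → 1 ≤ ∣ p ∣ → ∃ λ x → x ∈ p
nonempty {n = n} p 1≤ with nonempty? p
... | yes p≢∅ = p≢∅
... | no  p≡∅ with refl ← Empty-unique p≡∅ = contradiction 1≤ (<⇒≱ (s≤s (≤-reflexive (∣⊥∣≡0 n))))

-- Deciding Ramsey goodness and double saturation

module _ (G : Graph n) where
  open Graph G

  clique? : U.Decidable (IsClique G)
  clique? S = map′ (λ f {x} {y} → f x y) (λ f x y → f)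
    (all? λ x → all? λ y → x ∈? S →-dec (y ∈? S →-dec (¬? (x Fin.≟ y) →-dec x ~? y)))

  independent? : U.Decidable (IsIndependent G)
  independent? S = map′ (λ f {x} {y} → f x y) (λ f x y → f)
    (all? λ x → all? λ y → x ∈? S →-dec (y ∈? S →-dec ¬? (x ~? y)))

  independentOfSize? : ∀ t → Dec (∃ λ S → ∣ S ∣ ≡ t × IsIndependent G S)
  independentOfSize? t = anySubset? λ S → (∣ S ∣ ≟ t) ×-dec independent? S

  ramseyGood? : ∀ s t → Dec (RamseyGood s t G)
  ramseyGood? s t = ¬? (anySubset? λ S → (∣ S ∣ ≟ s) ×-dec clique? S) ×-dec ¬? (independentOfSize? t)

doublySaturated? : ∀ s t → U.Decidable (DoublySaturated {n} s t)
doublySaturated? s t G = map′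
  (λ (g , a , d) → record { good = g ; add-breaks = λ {u} {v} → a u v ; del-breaks = λ {u} {v} → d u v })
  (λ ds → let open DoublySaturated ds in good , (λ u v → add-breaks) , (λ u v → del-breaks))
  (ramseyGood? G s t ×-dec (all? λ u → all? (add? u)) ×-dec
    (all? λ u → all? λ v → (u ~? v) →-dec ¬? (ramseyGood? (deleteEdge G u v) s t)))
  where
  open Graph G
  add? : ∀ u v → Dec (∀ (u≢v : u ≢ v) → ¬ (u ~ v) → ¬ RamseyGood s t (addEdge G u v u≢v))
  add? u v with u Fin.≟ v
  ... | yes u≡v = yes λ u≢v → contradiction u≡v u≢v
  -- `addEdge` uses the proof of `u ≢ v` only for irreflexivity, so goodness of the new graph does
  -- not depend on it and one instance decides all.
  ... | no  u≢v = map′ (λ f _ → f) (λ f → f u≢v)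
                    (¬? (u ~? v) →-dec ¬? (ramseyGood? (addEdge G u v u≢v) s t))

-- Graphs up to equivalence, and their enumeration by matrices

infix 4 _≈_
_≈_ : Rel (Graph n) _
G ≈ H = ∀ {x y} → (x ~G y → x ~H y) × (x ~H y → x ~G y)
  where
  open Graph G renaming (_~_ to _~G_)
  open Graph H renaming (_~_ to _~H_)

ramseyGood-resp : ∀ {s t} {G H : Graph n} → G ≈ H → RamseyGood s t G → RamseyGood s t H
ramseyGood-resp G≈H (noClique , noIndependent) =
  (λ (S , size , c) → noClique (S , size , λ x∈ y∈ x≢y → proj₂ G≈H (c x∈ y∈ x≢y))) ,
  (λ (S , size , i) → noIndependent (S , size , λ x∈ y∈ x~y → i x∈ y∈ (proj₁ G≈H x~y)))

doublySaturated-resp : ∀ {s t} {G H : Graph n} → G ≈ H → DoublySaturated s t G → DoublySaturated s t H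
doublySaturated-resp {G = G} {H} G≈H ds = record
  { good       = ramseyGood-resp {G = G} {H} G≈H good
  ; add-breaks = λ {u} {v} u≢v u≁v g → add-breaks u≢v (u≁v ∘ proj₁ G≈H)
      (ramseyGood-resp {G = addEdge H u v u≢v} {addEdge G u v u≢v}
        (Sum.map₁ (proj₂ G≈H) , Sum.map₁ (proj₁ G≈H)) g)
  ; del-breaks = λ {u} {v} u~v g → del-breaks (proj₂ G≈H u~v)
      (ramseyGood-resp {G = deleteEdge H u v} {deleteEdge G u v}
        (Product.map₁ (proj₂ G≈H) , Product.map₁ (proj₁ G≈H)) g)
  }
  where open DoublySaturated ds

-- Symmetrised, so that every matrix yields a graph.
fromMatrix : Vec (Subset n) n → Graph n
fromMatrix M = record
  { _~_      = λ x y → x ≢ y × y ∈ lookup M x × x ∈ lookup M y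
  ; _~?_     = λ x y → ¬? (x Fin.≟ y) ×-dec y ∈? lookup M x ×-dec x ∈? lookup M y
  ; ~-sym    = λ (x≢y , p , q) → x≢y ∘ sym , q , p
  ; ~-irrefl = λ x≡y (x≢y , _) → x≢y x≡y
  }

toMatrix : Graph n → Vec (Subset n) n
toMatrix G = tabulate λ x → select (x ~?_)
  where open Graph G

fromMatrix-toMatrix : ∀ (G : Graph n) → G ≈ fromMatrix (toMatrix G)
fromMatrix-toMatrix G {x} {y} =
  (λ x~y → (λ x≡y → ~-irrefl x≡y x~y) , row⁺ x~y , row⁺ (~-sym x~y)) , λ (_ , p , _) → row⁻ p
  where
  open Graph G
  row⁺ : ∀ {x y} → x ~ y → y ∈ lookup (toMatrix G) x
  row⁺ {x} {y} x~y = subst (y ∈_) (sym (lookup∘tabulate _ x)) (∈-select⁺ (x ~?_) x~y)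
  row⁻ : ∀ {x y} → y ∈ lookup (toMatrix G) x → x ~ y
  row⁻ {x} {y} p = ∈-select⁻ (x ~?_) (subst (y ∈_) (lookup∘tabulate _ x) p)

anySubsets? : ∀ k {ℓ} {P : U.Pred (Vec (Subset n) k) ℓ} → U.Decidable P → Dec (∃ P)
anySubsets? zero    P? = map′ ([] ,_) (λ { ([] , P[]) → P[] }) (P? [])
anySubsets? (suc k) P? = map′ (λ (S , Ss , p) → S ∷ Ss , p) (λ { (S ∷ Ss , p) → S , Ss , p })
  (anySubset? λ S → anySubsets? k (P? ∘ (S ∷_)))

-- Adjacency is an arbitrary relation, so graphs cannot be enumerated directly. But double
-- saturation depends only on the edges, and every graph is equivalent to one given by a Boolean
-- matrix, of which there are finitely many.
hasDoublySaturated? : ∀ s t → U.Decidable (HasDoublySaturated s t)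
hasDoublySaturated? s t n = (2 ≤? n) ×-dec map′
  (λ (M , ds) → fromMatrix M , ds)
  (λ (G , ds) → toMatrix G , doublySaturated-resp {G = G} {fromMatrix (toMatrix G)} (fromMatrix-toMatrix G) ds)
  (anySubsets? n (doublySaturated? s t ∘ fromMatrix))

-- Triangles and cliques of order three

module _ (G : Graph n) where
  open Graph G

  Triangle : Set
  Triangle = ∃ λ x → ∃ λ y → ∃ λ z → x ~ y × y ~ z × x ~ z

  clique⇒triangle : (∃ λ S → ∣ S ∣ ≡ 3 × IsClique G S) → Triangle
  clique⇒triangle (S , size , clique) =
    let x , x∈S   = nonempty S (≤-trans (s≤s z≤n) (≤-reflexive (sym size)))
        ∣S-x∣≡2   = suc-injective (trans (∣p-x∣ x∈S) size)
        y , y∈    = nonempty (S - x) (≤-trans (s≤s z≤n) (≤-reflexive (sym ∣S-x∣≡2)))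
        ∣S-x-y∣≡1 = suc-injective (trans (∣p-x∣ y∈) ∣S-x∣≡2)
        z , z∈    = nonempty (S - x - y) (≤-reflexive (sym ∣S-x-y∣≡1))
        y∈S       = p─q⊆p S ⁅ x ⁆ y∈
        z∈S-x     = p─q⊆p (S - x) ⁅ y ⁆ z∈
        z∈S       = p─q⊆p S ⁅ x ⁆ z∈S-x
    in x , y , z , clique x∈S y∈S (∈-⇒≢ S y∈ ∘ sym)
             , clique y∈S z∈S (∈-⇒≢ (S - x) z∈ ∘ sym)
             , clique x∈S z∈S (∈-⇒≢ S z∈S-x ∘ sym)

  triangle⇒clique : Triangle → ∃ λ S → ∣ S ∣ ≡ 3 × IsClique G S
  triangle⇒clique (x , y , z , x~y , y~z , x~z) = ⁅ x ⁆ ∪ (⁅ y ⁆ ∪ ⁅ z ⁆) , size , clique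
    where
    size : ∣ ⁅ x ⁆ ∪ (⁅ y ⁆ ∪ ⁅ z ⁆) ∣ ≡ 3
    size = trans (disjoint-∣∪∣ ⁅ x ⁆ (⁅ y ⁆ ∪ ⁅ z ⁆) λ a∈x → Sum.[ apart x~y a∈x , apart x~z a∈x ] ∘ x∈p∪q⁻ ⁅ y ⁆ ⁅ z ⁆)
                 (cong₂ _+_ (∣⁅x⁆∣≡1 x) (trans (disjoint-∣∪∣ ⁅ y ⁆ ⁅ z ⁆ (apart y~z)) (cong₂ _+_ (∣⁅x⁆∣≡1 y) (∣⁅x⁆∣≡1 z))))
      where
      apart : ∀ {a b c} → a ~ b → c ∈ ⁅ a ⁆ → c ∉ ⁅ b ⁆
      apart a~b c∈a c∈b = ~-irrefl (trans (sym (x∈⁅y⁆⇒x≡y _ c∈a)) (x∈⁅y⁆⇒x≡y _ c∈b)) a~b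

    cases : ∀ {a} → a ∈ ⁅ x ⁆ ∪ (⁅ y ⁆ ∪ ⁅ z ⁆) → a ≡ x ⊎ a ≡ y ⊎ a ≡ z
    cases = Sum.map (x∈⁅y⁆⇒x≡y x) (Sum.map (x∈⁅y⁆⇒x≡y y) (x∈⁅y⁆⇒x≡y z) ∘ x∈p∪q⁻ ⁅ y ⁆ ⁅ z ⁆) ∘ x∈p∪q⁻ ⁅ x ⁆ _

    clique : IsClique G (⁅ x ⁆ ∪ (⁅ y ⁆ ∪ ⁅ z ⁆))
    clique a∈ b∈ a≢b with cases a∈ | cases b∈
    ... | inj₁ refl        | inj₁ refl        = contradiction refl a≢b
    ... | inj₁ refl        | inj₂ (inj₁ refl) = x~y
    ... | inj₁ refl        | inj₂ (inj₂ refl) = x~z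
    ... | inj₂ (inj₁ refl) | inj₁ refl        = ~-sym x~y
    ... | inj₂ (inj₁ refl) | inj₂ (inj₁ refl) = contradiction refl a≢b
    ... | inj₂ (inj₁ refl) | inj₂ (inj₂ refl) = y~z
    ... | inj₂ (inj₂ refl) | inj₁ refl        = ~-sym x~z
    ... | inj₂ (inj₂ refl) | inj₂ (inj₁ refl) = ~-sym y~z
    ... | inj₂ (inj₂ refl) | inj₂ (inj₂ refl) = contradiction refl a≢b

-- Lower bound

module LowerBound {n t} (G : Graph n) (saturated : DoublySaturated 3 t G) (n≥2 : 2 ≤ n) (t≥3 : 3 ≤ t) where
  open Graph G
  open DoublySaturated saturated

  independent-< : ∀ {S} → IsIndependent G S → ∣ S ∣ < t
  independent-< {S} ind = ≰⇒> λ t≤ → let S′ , S′⊆S , size = subset-of-size S t≤ in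
    proj₂ good (S′ , size , λ x∈ y∈ → ind (S′⊆S x∈) (S′⊆S y∈))

  opaque
    -- Adding an edge creates no independent set, so by saturation it creates a triangle, whose
    -- third vertex is the witness. Decidability of the search removes the double negation.
    common-neighbour : ∀ {u v} → u ≢ v → ¬ u ~ v → ∃ λ w → w ~ u × w ~ v
    common-neighbour {u} {v} u≢v u≁v = decidable-stable (any? λ w → (w ~? u) ×-dec (w ~? v)) λ none →
      add-breaks u≢v u≁v
        ( noTriangle none ∘ clique⇒triangle G+uv
        , λ (S , size , ind) → proj₂ good (S , size , λ x∈ y∈ x~y → ind x∈ y∈ (inj₁ x~y)))
      where
      G+uv : Graph n
      G+uv = addEdge G u v u≢v
      open Graph G+uv using () renaming (_~_ to _≈⁺_; ~-sym to ≈⁺-sym; ~-irrefl to ≈⁺-irrefl)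

      old : ∀ {x y z} → SamePair u v x y → z ≢ y → z ≈⁺ x → z ~ x
      old _                      z≢y (inj₁ z~x)                 = z~x
      old (inj₁ (refl , refl))   z≢y (inj₂ (inj₁ (_ , u≡v)))    = contradiction u≡v u≢v
      old (inj₁ (refl , refl))   z≢y (inj₂ (inj₂ (z≡v , _)))    = contradiction z≡v z≢y
      old (inj₂ (refl , refl))   z≢y (inj₂ (inj₁ (z≡u , _)))    = contradiction z≡u z≢y
      old (inj₂ (refl , refl))   z≢y (inj₂ (inj₂ (_ , v≡u)))    = contradiction (sym v≡u) u≢v

      module _ (none : ¬ ∃ λ w → w ~ u × w ~ v) where
        -- The sides from `z` avoid the new edge, since `z` is neither of its ends. They are
        -- therefore old and make `z` a common neighbour.
        apex : ∀ {x y z} → SamePair u v x y → z ≈⁺ x → ¬ z ≈⁺ y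
        apex {x} {y} {z} new zx zy = common new
          (old new (λ z≡y → ≈⁺-irrefl z≡y zy) zx)
          (old (samePair-sym u v new) (λ z≡x → ≈⁺-irrefl z≡x zx) zy)
          where
          common : SamePair u v x y → z ~ x → ¬ z ~ y
          common (inj₁ (refl , refl)) z~u z~v = none (z , z~u , z~v)
          common (inj₂ (refl , refl)) z~v z~u = none (z , z~u , z~v)

        noTriangle : ¬ Triangle G+uv
        noTriangle (x , y , z , inj₂ new , yz , xz) = apex new (≈⁺-sym xz) (≈⁺-sym yz)
        noTriangle (x , y , z , xy , inj₂ new , xz) = apex new xy xz
        noTriangle (x , y , z , xy , yz , inj₂ new) = apex new (≈⁺-sym xy) yz
        noTriangle (x , y , z , inj₁ xy , inj₁ yz , inj₁ xz) =
          proj₁ good (triangle⇒clique G (x , y , z , xy , yz , xz))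

  -- The set that becomes independent when the edge `uv` is deleted.
  record Critical (u v : Fin n) : Set where
    field
      B     : Subset n
      ∣B∣≡t : ∣ B ∣ ≡ t
      u∈B   : u ∈ B
      v∈B   : v ∈ B
      only  : ∀ {x y} → x ∈ B → y ∈ B → x ~ y → SamePair u v x y

  opaque
    -- Deletion creates no clique, so it creates an independent `t`-set. As this set is not
    -- independent in `G`, it contains both ends of the deleted edge.
    critical : ∀ {u v} → u ~ v → Critical u v
    critical {u} {v} u~v = build (decidable-stable (independentOfSize? (deleteEdge G u v) t) λ none →
      del-breaks u~v ((λ (S , size , c) → proj₁ good (S , size , λ x∈ y∈ x≢y → proj₁ (c x∈ y∈ x≢y))) , none))
      where
      build : (∃ λ B → ∣ B ∣ ≡ t × IsIndependent (deleteEdge G u v) B) → Critical u v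
      build (B , size , ind) = record
        { B     = B
        ; ∣B∣≡t = size
        ; u∈B   = decidable-stable (u ∈? B) λ u∉B → escape λ where
            x∈ y∈ (inj₁ (refl , _)) → u∉B x∈
            x∈ y∈ (inj₂ (_ , refl)) → u∉B y∈
        ; v∈B   = decidable-stable (v ∈? B) λ v∉B → escape λ where
            x∈ y∈ (inj₁ (_ , refl)) → v∉B y∈
            x∈ y∈ (inj₂ (refl , _)) → v∉B x∈
        ; only  = only
        }
        where
        only : ∀ {x y} → x ∈ B → y ∈ B → x ~ y → SamePair u v x y
        only {x} {y} x∈ y∈ x~y = decidable-stable (samePair? u v x y) λ ¬same → ind x∈ y∈ (x~y , ¬same)
        escape : ¬ (∀ {x y} → x ∈ B → y ∈ B → ¬ SamePair u v x y)
        escape none = proj₂ good (B , size , λ x∈ y∈ x~y → none x∈ y∈ (only x∈ y∈ x~y))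

  -- As `t ≥ 3`, the critical set of `sw` has a third vertex `x`, adjacent to neither `s` nor `w`. A
  -- common neighbour of `x` and `s` therefore differs from `w`.
  second-neighbour : ∀ {s w} → s ~ w → ∃ λ w′ → s ~ w′ × w′ ≢ w
  second-neighbour {s} {w} s~w = via (nonempty (B - s - w) (s≤s⁻¹ (s≤s⁻¹ (≤-trans t≥3 (≤-reflexive (sym size))))))
    where
    open Critical (critical s~w)
    size : suc (suc ∣ B - s - w ∣) ≡ t
    size = trans (cong suc (∣p-x∣ (x∈p∧x≢y⇒x∈p-y v∈B λ w≡s → ~-irrefl (sym w≡s) s~w))) (trans (∣p-x∣ u∈B) ∣B∣≡t)

    via : (∃ λ x → x ∈ B - s - w) → ∃ λ w′ → s ~ w′ × w′ ≢ w
    via (x , x∈) = let c , c~x , c~s = common-neighbour x≢s (isolated u∈B) in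
      c , ~-sym c~s , λ c≡w → isolated v∈B (subst (x ~_) c≡w (~-sym c~x))
      where
      x∈B-s : x ∈ B - s
      x∈B-s = p─q⊆p (B - s) ⁅ w ⁆ x∈
      x≢s : x ≢ s
      x≢s = ∈-⇒≢ B x∈B-s
      isolated : ∀ {y} → y ∈ B → ¬ x ~ y
      isolated y∈B x~y with only (p─q⊆p B ⁅ s ⁆ x∈B-s) y∈B x~y
      ... | inj₁ (x≡s , _) = x≢s x≡s
      ... | inj₂ (x≡w , _) = ∈-⇒≢ (B - s) x∈ x≡w

  neighbour : ∀ s → ∃ λ w → s ~ w
  neighbour s = toward (another n≥2 s)
    where
    another : ∀ {n} → 2 ≤ n → (s : Fin n) → ∃ λ y → s ≢ y
    another (s≤s (s≤s _)) zero    = suc zero , λ ()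
    another (s≤s (s≤s _)) (suc _) = zero , λ ()

    toward : (∃ λ y → s ≢ y) → ∃ λ w → s ~ w
    toward (y , s≢y) with s ~? y
    ... | yes s~y = y , s~y
    ... | no  s≁y = let c , c~s , _ = common-neighbour s≢y s≁y in c , ~-sym c~s

  -- Expansion of independent sets

  neighbourOf? : ∀ S w → Dec (∃ λ s → s ∈ S × s ~ w)
  neighbourOf? S w = any? λ s → (s ∈? S) ×-dec (s ~? w)

  N : Subset n → Subset n
  N S = select (neighbourOf? S)

  ∈N⁺ : ∀ {S s w} → s ∈ S → s ~ w → w ∈ N S
  ∈N⁺ {S} s∈S s~w = ∈-select⁺ (neighbourOf? S) (_ , s∈S , s~w)

  ∈N⁻ : ∀ {S w} → w ∈ N S → ∃ λ s → s ∈ S × s ~ w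
  ∈N⁻ {S} = ∈-select⁻ (neighbourOf? S)

  independent-disjoint : ∀ {S x} → IsIndependent G S → x ∈ S → x ∉ N S
  independent-disjoint ind x∈S x∈N with s , s∈S , s~x ← ∈N⁻ x∈N = ind s∈S x∈S s~x

  -- Induction on a bound for `∣ S ∣`. Let `B` be critical for an edge `sw` with `s ∈ S`, and `R`
  -- the rest of `S` inside `B`. Then `N S` contains two disjoint sets: `B ∩ N S`, larger than
  -- `S ─ B` by exchange, and `N R`, which avoids `B` and is larger than `R` by induction.
  expansion : ∀ k {S} → ∣ S ∣ ≤ k → 1 ≤ ∣ S ∣ → IsIndependent G S → ∣ S ∣ < ∣ N S ∣
  expansion zero    small large _ = contradiction (≤-trans large small) λ ()
  expansion (suc k) {S} small large ind =
    let s , s∈S = nonempty S large ; w , s~w = neighbour s in from s∈S s~w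
    where
    from : ∀ {s w} → s ∈ S → s ~ w → ∣ S ∣ < ∣ N S ∣
    from {s} {w} s∈S s~w = conclude (1 ≤? ∣ R ∣)
     where
      open Critical (critical s~w)
      R : Subset n
      R = S ∩ B - s

      R⊆S : R ⊆ S
      R⊆S = p∩q⊆p S B ∘ p─q⊆p (S ∩ B) ⁅ s ⁆
      R⊆B : R ⊆ B
      R⊆B = p∩q⊆q S B ∘ p─q⊆p (S ∩ B) ⁅ s ⁆

      ∣S∣ : ∣ S ∣ ≡ suc ∣ R ∣ + ∣ S ─ B ∣
      ∣S∣ = trans (sym (∣p∩q∣+∣p─q∣≡∣p∣ S B)) (cong (_+ ∣ S ─ B ∣) (sym (∣p-x∣ (x∈p∩q⁺ (s∈S , u∈B)))))

      -- The neighbours of `S` in `B` are traded for `S`. Among them is `w`, so the only edge of `B`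
      -- disappears.
      exchanged : IsIndependent G ((B ─ N S) ∪ S)
      exchanged {x} {y} x∈ y∈ x~y with x∈p∪q⁻ (B ─ N S) S x∈ | x∈p∪q⁻ (B ─ N S) S y∈
      ... | inj₂ x∈S | inj₂ y∈S = ind x∈S y∈S x~y
      ... | inj₂ x∈S | inj₁ y∈B = ∈─⇒∉ B (N S) y∈B (∈N⁺ x∈S x~y)
      ... | inj₁ x∈B | inj₂ y∈S = ∈─⇒∉ B (N S) x∈B (∈N⁺ y∈S (~-sym x~y))
      ... | inj₁ x∈B | inj₁ y∈B with only (p─q⊆p B _ x∈B) (p─q⊆p B _ y∈B) x~y
      ...   | inj₁ (_ , refl) = ∈─⇒∉ B (N S) y∈B (∈N⁺ s∈S s~w)
      ...   | inj₂ (refl , _) = ∈─⇒∉ B (N S) x∈B (∈N⁺ s∈S s~w)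

      -- The exchanged set is independent, hence smaller than `B`: fewer vertices enter than leave.
      gain : ∣ S ─ B ∣ < ∣ B ∩ N S ∣
      gain = +-cancelʳ-< (∣ B ─ N S ∣) (∣ S ─ B ∣) (∣ B ∩ N S ∣) (begin-strict
        ∣ S ─ B ∣ + ∣ B ─ N S ∣        ≡⟨ +-comm ∣ S ─ B ∣ _ ⟩
        ∣ B ─ N S ∣ + ∣ S ─ B ∣        ≡⟨ disjoint-∣∪∣ (B ─ N S) (S ─ B) (λ x∈B x∈S → ∈─⇒∉ S B x∈S (p─q⊆p B _ x∈B)) ⟨
        ∣ (B ─ N S) ∪ (S ─ B) ∣        ≤⟨ p⊆q⇒∣p∣≤∣q∣ (x∈p∪q⁺ ∘ Sum.map₂ (p─q⊆p S B) ∘ x∈p∪q⁻ (B ─ N S) (S ─ B)) ⟩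
        ∣ (B ─ N S) ∪ S ∣              <⟨ independent-< exchanged ⟩
        t                              ≡⟨ ∣B∣≡t ⟨
        ∣ B ∣                          ≡⟨ ∣p∩q∣+∣p─q∣≡∣p∣ B (N S) ⟨
        ∣ B ∩ N S ∣ + ∣ B ─ N S ∣      ∎)
        where open ≤-Reasoning

      -- Applied with `r = suc ∣ R ∣`, where the left side becomes `suc ∣ S ∣`.
      count : ∀ {r} X → r ≤ ∣ X ∣ → X ⊆ N S → (∀ {x} → x ∈ X → x ∉ B) → suc (r + ∣ S ─ B ∣) ≤ ∣ N S ∣
      count {r} X r≤ X⊆N X∩B = begin
        suc (r + ∣ S ─ B ∣)      ≡⟨ +-suc r _ ⟨
        r + suc ∣ S ─ B ∣        ≤⟨ +-mono-≤ r≤ gain ⟩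
        ∣ X ∣ + ∣ B ∩ N S ∣      ≡⟨ disjoint-∣∪∣ X (B ∩ N S) (λ x∈X x∈B → X∩B x∈X (p∩q⊆p B _ x∈B)) ⟨
        ∣ X ∪ (B ∩ N S) ∣        ≤⟨ p⊆q⇒∣p∣≤∣q∣ (Sum.[ X⊆N , p∩q⊆q B (N S) ] ∘ x∈p∪q⁻ X _) ⟩
        ∣ N S ∣                  ∎
        where open ≤-Reasoning

      conclude : _ → ∣ S ∣ < ∣ N S ∣
      conclude (yes R≢∅) = subst (_< ∣ N S ∣) (sym ∣S∣) (count (N R)
        (expansion k (s≤s⁻¹ (≤-trans (≤-trans (m≤m+n _ _) (≤-reflexive (sym ∣S∣))) small)) R≢∅
          (λ x∈ y∈ → ind (R⊆S x∈) (R⊆S y∈)))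
        (λ x∈ → let r , r∈R , r~x = ∈N⁻ x∈ in ∈N⁺ (R⊆S r∈R) r~x)
        avoids-B)
        where
        -- An edge from `r` inside `B` forces `r` to be `s` or `w`; but `s` is removed from `R`, and
        -- `w` is adjacent to `s ∈ S`.
        avoids-B : ∀ {x} → x ∈ N R → x ∉ B
        avoids-B x∈N x∈B with r , r∈R , r~x ← ∈N⁻ x∈N with only (R⊆B r∈R) x∈B r~x
        ... | inj₁ (refl , _) = ∈-⇒≢ (S ∩ B) r∈R refl
        ... | inj₂ (refl , _) = ind s∈S (R⊆S r∈R) s~w
      -- A second neighbour of `s` stands in for `N R`; it lies outside `B` because `w` is the only
      -- neighbour of `s` in `B`.
      conclude (no R≡∅) with w′ , s~w′ , w′≢w ← second-neighbour s~w =
        subst (_< ∣ N S ∣) (sym ∣S∣) (count ⁅ w′ ⁆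
          (≤-trans (s≤s (≮⇒≥ R≡∅)) (≤-reflexive (sym (∣⁅x⁆∣≡1 w′))))
          (λ x∈ → subst (_∈ N S) (sym (x∈⁅y⁆⇒x≡y w′ x∈)) (∈N⁺ s∈S s~w′))
          (λ x∈ x∈B → avoids-B (subst (_∈ B) (x∈⁅y⁆⇒x≡y w′ x∈) x∈B)))
        where
        avoids-B : w′ ∉ B
        avoids-B w′∈B with only u∈B w′∈B s~w′
        ... | inj₁ (_ , w′≡w) = w′≢w w′≡w
        ... | inj₂ (s≡w , _)  = ~-irrefl s≡w s~w


  lower-bound : 2 * t ∸ 1 ≤ n
  lower-bound = from (proj₂ (neighbour (Fin.fromℕ< {0} (≤-trans (s≤s z≤n) n≥2))))
    where
    from : ∀ {u v} → u ~ v → 2 * t ∸ 1 ≤ n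
    from {u} {v} u~v = m≤n+o⇒m∸n≤o (2 * t) 1 (begin
      2 * t                    ≡⟨ cong (t +_) (+-identityʳ t) ⟩
      t + t                    ≡⟨ cong (_+ t) size ⟨
      suc (∣ A ∣ + t)          ≤⟨ s≤s (+-monoʳ-≤ ∣ A ∣ (subst (_≤ ∣ N A ∣) size
                                    (expansion t (<⇒≤ (≤-reflexive size)) large ind))) ⟩
      suc (∣ A ∣ + ∣ N A ∣)    ≡⟨ cong suc (disjoint-∣∪∣ A (N A) (independent-disjoint ind)) ⟨
      suc ∣ A ∪ N A ∣          ≤⟨ s≤s (∣p∣≤n (A ∪ N A)) ⟩
      suc n                    ∎)
      where
      open ≤-Reasoning
      open Critical (critical u~v)
      -- Without one end of its only edge, `B` is independent of size `t ∸ 1`; with at least `t`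
      -- neighbours this gives `2 * t ∸ 1` vertices.
      A : Subset n
      A = B - u
      size : suc ∣ A ∣ ≡ t
      size = trans (∣p-x∣ u∈B) ∣B∣≡t
      large : 1 ≤ ∣ A ∣
      large = ≤-trans (s≤s z≤n) (s≤s⁻¹ (≤-trans t≥3 (≤-reflexive (sym size))))
      ind : IsIndependent G A
      ind x∈ y∈ x~y with only (p─q⊆p B _ x∈) (p─q⊆p B _ y∈) x~y
      ... | inj₁ (x≡u , _) = ∈-⇒≢ B x∈ x≡u
      ... | inj₂ (_ , y≡u) = ∈-⇒≢ B y∈ y≡u

-- Branch and bound

next prev : Fin 5 → Fin 5
next zero                         = # 1
next (suc zero)                   = # 2
next (suc (suc zero))             = # 3
next (suc (suc (suc zero)))       = # 4
next (suc (suc (suc (suc zero)))) = # 0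
prev zero                         = # 4
prev (suc zero)                   = # 0
prev (suc (suc zero))             = # 1
prev (suc (suc (suc zero)))       = # 2
prev (suc (suc (suc (suc zero)))) = # 3

next-prev : ∀ i → next (prev i) ≡ i
next-prev zero                         = refl
next-prev (suc zero)                   = refl
next-prev (suc (suc zero))             = refl
next-prev (suc (suc (suc zero)))       = refl
next-prev (suc (suc (suc (suc zero)))) = refl

AllPairs-resp-↭ : ∀ {A : Set} {R : A → A → Set} → Symmetric R →
                  ∀ {xs ys} → xs ↭ ys → AllPairs R xs → AllPairs R ys
AllPairs-resp-↭ R-sym ↭.refl         ps       = ps
AllPairs-resp-↭ R-sym (↭.prep x p)   (q ∷ ps) = All-resp-↭ p q ∷ AllPairs-resp-↭ R-sym p ps
AllPairs-resp-↭ R-sym (↭.swap x y p) ((xRy ∷ q) ∷ (r ∷ ps)) =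
  (R-sym xRy ∷ All-resp-↭ p r) ∷ (All-resp-↭ p q ∷ AllPairs-resp-↭ R-sym p ps)
AllPairs-resp-↭ R-sym (↭.trans p q)  ps       = AllPairs-resp-↭ R-sym q (AllPairs-resp-↭ R-sym p ps)

∧-T : ∀ {a b} → T (a ∧ b) → T a × T b
∧-T = Equivalence.to T-∧

∨-T : ∀ {a b} → T (a ∨ b) → T a ⊎ T b
∨-T = Equivalence.to T-∨

not∨-T : ∀ {a b} → a ≡ true → T (not a ∨ b) → T b
not∨-T refl t = t

all-Fin : ∀ {n} (p : Fin n → Bool) → T (all p (allFin n)) → ∀ i → T (p i)
all-Fin p ok i = All.lookup (All.all⁺ p _ ok) (∈-allFin i)

module Search {V : Set} (arc : V → V → Bool) where

  -- A vertex and the layers still allowed for it.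
  Row : Set
  Row = V × Subset 5

  -- Placing `v` in layer `i` excludes `next i` for `w` if `v → w`, and `prev i` if `w → v`.
  forbid : V → Fin 5 → Row → Row
  forbid v i (w , L) = w , L [ if arc v w then next i else prev i ]≔ outside

  restrict : V → Fin 5 → List Row → List Row
  restrict v i = map (forbid v i)

  dead : Subset 5 → Bool
  dead (false ∷ false ∷ false ∷ false ∷ false ∷ []) = true
  dead _                                            = false

  deads : List Row → ℕ
  deads []               = 0
  deads ((_ , L) ∷ rows) = if dead L then suc (deads rows) else deads rows

  -- refuteSingles fuel rows u: if every vertex gets at most one allowed layer, more than u get none.
  refuteSingles : ℕ → List Row → ℕ → Bool
  branch        : ℕ → List Row → ℕ → Bool
  leaveOut      : ℕ → List Row → ℕ → Bool
  refuteSingles fuel rows u = (u <ᵇ deads rows) ∨ branch fuel rows u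
  branch (suc fuel) ((v , L) ∷ rows) u =
    all (λ j → not (lookup L j) ∨ refuteSingles fuel (restrict v j rows) u) (allFin 5)
    ∧ leaveOut fuel rows u
  -- Without vertices or fuel nothing is refuted, so `false` is the safe default.
  branch _ _ u = false
  -- One vertex has just been left out, which already exceeds 0.
  leaveOut fuel rows zero    = true
  leaveOut fuel rows (suc u) = refuteSingles fuel rows u

  -- A double of type i is a vertex in layers i and next i.  refute is rows k: with k doubles already placed,
  -- and all others of distinct types in is, the doubles outnumber the vertices left out by at most one.
  refute  : List (Fin 5) → List Row → ℕ → Bool
  doubles : Fin 5 → List (Fin 5) → List Row → List Row → ℕ → Bool
  -- Only singles remain. With `u + 2` doubles placed, more than `u` vertices must be left out; with
  -- fewer than two doubles there is nothing to show.
  refute []       rows (suc (suc u)) = refuteSingles (length rows) rows u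
  refute []       rows k             = true
  refute (i ∷ is) rows k             = doubles i is [] rows k ∧ refute is rows k
  doubles i is seen []               k = true
  doubles i is seen ((v , L) ∷ rows) k =
    (not (lookup L i ∧ lookup L (next i)) ∨
      refute is (restrict v (next i) (restrict v i (seen ʳ++ rows))) (suc k))
    ∧ doubles i is ((v , L) ∷ seen) rows k

  check : List V → Bool
  check vs = refute (allFin 5) (map (_, ⊤) vs) 0

  -- Soundness of the search

  Linked : V → V → Set
  Linked v w = T (arc v w) ⊎ T (arc w v)

  Linked-sym : Symmetric Linked
  Linked-sym (inj₁ a) = inj₂ a
  Linked-sym (inj₂ a) = inj₁ a

  module _ (c : V → Subset 5)
           (valid : ∀ v w → T (arc v w) → ∀ {i} → i ∈ c v → next i ∉ c w) where

    Fits : Row → Set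
    Fits (v , L) = c v ⊆ L

    -- Ties a search state to the unknown `c`: the layers actually used by each remaining vertex are
    -- still allowed.
    record Sound (rows : List Row) : Set where
      constructor sound
      field
        fits   : All Fits rows
        linked : AllPairs (λ r s → Linked (proj₁ r) (proj₁ s)) rows
    open Sound

    total : List Row → ℕ
    total rows = sum (map (∣_∣ ∘ c ∘ proj₁) rows)

    Sound-↭ : ∀ {rs ss} → rs ↭ ss → Sound rs → Sound ss
    Sound-↭ p (sound f l) = sound (All-resp-↭ p f) (AllPairs-resp-↭ Linked-sym p l)

    total-↭ : ∀ {rs ss} → rs ↭ ss → total rs ≡ total ss
    total-↭ p = sum-↭ (↭-map⁺ _ p)

    forbid-fits : ∀ {v w i L} → Linked v w → i ∈ c v → c w ⊆ L →
                  c w ⊆ proj₂ (forbid v i (w , L))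
    forbid-fits {v} {w} {i} {L} link i∈v fit x∈w =
      []≔-minimal L _ _ (λ { refl → excluded link x∈w }) (fit x∈w)
      where
      excluded : Linked v w → (if arc v w then next i else prev i) ∉ c w
      excluded link k∈w with arc v w in eq
      excluded link        k∈w | true  = valid v w (subst T (sym eq) tt) i∈v k∈w
      excluded (inj₂ w→v) k∈w | false = valid w v w→v k∈w (subst (_∈ c v) (sym (next-prev i)) i∈v)

    restrict-all : ∀ {P : V → Set} v i {rows} → All (P ∘ proj₁) rows →
                   All (P ∘ proj₁) (restrict v i rows)
    restrict-all v i = All.map⁺

    restrict-sound : ∀ {v} i {rows} → i ∈ c v → All (Linked v ∘ proj₁) rows →
                     Sound rows → Sound (restrict v i rows)
    restrict-sound {v} i i∈v ls (sound fs ps) = sound (go ls fs) (AllPairs.map⁺ ps)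
      where
      go : ∀ {rows} → All (Linked v ∘ proj₁) rows → All Fits rows → All Fits (restrict v i rows)
      go []       []       = []
      go {(_ , L) ∷ _} (l ∷ ls) (f ∷ fs) = forbid-fits {L = L} l i∈v f ∷ go ls fs

    total-restrict : ∀ v i rows → total (restrict v i rows) ≡ total rows
    total-restrict v i []         = refl
    total-restrict v i (r ∷ rows) = cong (∣ c (proj₁ r) ∣ +_) (total-restrict v i rows)

    Single : V → Set
    Single v = ∣ c v ∣ ≤ 1

    dead-empty : ∀ {L} v → T (dead L) → c v ⊆ L → ∣ c v ∣ ≡ 0
    dead-empty {false ∷ false ∷ false ∷ false ∷ false ∷ []} v d fit with nonempty? (c v)
    ... | no  empty     = trans (cong ∣_∣ (Empty-unique empty)) (∣⊥∣≡0 5)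
    ... | yes (i , i∈v) = contradiction (fit i∈v) ∉⊥

    total+deads : ∀ {rows} → All Fits rows → All (Single ∘ proj₁) rows →
                  total rows + deads rows ≤ length rows
    total+deads []       []       = z≤n
    total+deads {(v , L) ∷ rows} (f ∷ fs) (s ∷ ss) with dead L in eq
    ... | true  = begin
      ∣ c v ∣ + total rows + suc (deads rows) ≡⟨ cong (λ z → z + total rows + suc (deads rows))
                                                  (dead-empty {L} v (subst T (sym eq) tt) f) ⟩
      total rows + suc (deads rows)           ≡⟨ +-suc (total rows) (deads rows) ⟩
      suc (total rows + deads rows)           ≤⟨ s≤s (total+deads fs ss) ⟩
      suc (length rows)                       ∎
      where open ≤-Reasoning
    ... | false = begin
      ∣ c v ∣ + total rows + deads rows   ≡⟨ +-assoc ∣ c v ∣ (total rows) (deads rows) ⟩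
      ∣ c v ∣ + (total rows + deads rows) ≤⟨ +-mono-≤ s (total+deads fs ss) ⟩
      suc (length rows)                   ∎
      where open ≤-Reasoning

    total-singles : ∀ {rows} → All (Single ∘ proj₁) rows → total rows ≤ length rows
    total-singles []       = z≤n
    total-singles (s ∷ ss) = +-mono-≤ s (total-singles ss)

    -- For singles, `length rows` minus `total rows` is the number of vertices left out.
    refuteSingles-sound : ∀ fuel {rows} u → T (refuteSingles fuel rows u) → Sound rows →
                          All (Single ∘ proj₁) rows → total rows + u < length rows
    branch-sound : ∀ fuel {rows} u → T (branch fuel rows u) → Sound rows →
                   All (Single ∘ proj₁) rows → total rows + u < length rows
    leaveOut-sound : ∀ fuel {rows} u → T (leaveOut fuel rows u) → Sound rows →
                     All (Single ∘ proj₁) rows → total rows + u ≤ length rows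

    refuteSingles-sound fuel {rows} u ok snd ss with ∨-T {u <ᵇ deads rows} ok
    ... | inj₁ u<d = <-≤-trans (+-monoʳ-< (total rows) (<ᵇ⇒< u (deads rows) u<d))
                               (total+deads (fits snd) ss)
    ... | inj₂ ok′ = branch-sound fuel u ok′ snd ss

    branch-sound (suc fuel) {(v , L) ∷ rows} u ok (sound (f ∷ fs) (l ∷ ls)) (s ∷ ss)
      with nonempty? (c v)
    ... | no empty = s≤s (subst (λ z → z + total rows + u ≤ length rows)
                           (sym (trans (cong ∣_∣ (Empty-unique empty)) (∣⊥∣≡0 5)))
                           (leaveOut-sound fuel u (proj₂ (∧-T {all test (allFin 5)} ok)) (sound fs ls) ss))
      where
      test : Fin 5 → Bool
      test j = not (lookup L j) ∨ refuteSingles fuel (restrict v j rows) u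
    ... | yes (j , j∈v) = begin
      suc (∣ c v ∣ + total rows + u)   ≤⟨ s≤s (+-monoˡ-≤ u (+-monoˡ-≤ (total rows) s)) ⟩
      suc (suc (total rows + u))       ≡⟨ cong (λ z → suc (suc (z + u))) (total-restrict v j rows) ⟨
      suc (suc (total (restrict v j rows) + u)) ≤⟨ s≤s ih ⟩
      suc (length (restrict v j rows)) ≡⟨ cong suc (List.length-map _ rows) ⟩
      suc (length rows)                ∎
      where
      open ≤-Reasoning
      test : Fin 5 → Bool
      test j = not (lookup L j) ∨ refuteSingles fuel (restrict v j rows) u
      ih = refuteSingles-sound fuel u
             (not∨-T ([]=⇒lookup (f j∈v)) (all-Fin test (proj₁ (∧-T {all test (allFin 5)} ok)) j))
             (restrict-sound j j∈v l (sound fs ls)) (restrict-all v j ss)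

    leaveOut-sound fuel {rows} zero    ok snd ss rewrite +-identityʳ (total rows) = total-singles ss
    leaveOut-sound fuel {rows} (suc u) ok snd ss rewrite +-suc (total rows) u =
      refuteSingles-sound fuel u ok snd ss

    Double : List (Fin 5) → V → Set
    Double is v = ∣ c v ∣ ≤ 1
                ⊎ ∃ λ i → i List.∈ is × i ∈ c v × next i ∈ c v × ∣ c v ∣ ≤ 2

    drop-type : ∀ {v i is} → Double (i ∷ is) v → ¬ (i ∈ c v × next i ∈ c v) → Double is v
    drop-type (inj₁ s)                        ¬d = inj₁ s
    drop-type (inj₂ (i , here refl , p , q , _)) ¬d = contradiction (p , q) ¬d
    drop-type (inj₂ (i , there i∈ , p))       ¬d = inj₂ (i , i∈ , p)

    -- Along an arc, layer `i` of the tail conflicts with layer `next i` of the head. Hence the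
    -- search may spend each type once, and there are at most five doubles.
    type-unique : ∀ {v w i} → Linked v w → i ∈ c v → next i ∈ c v → i ∈ c w → next i ∉ c w
    type-unique (inj₁ v→w) i∈v ni∈v i∈w ni∈w = valid _ _ v→w i∈v ni∈w
    type-unique (inj₂ w→v) i∈v ni∈v i∈w ni∈w = valid _ _ w→v i∈w ni∈v

    -- The `k` placed doubles are no longer among the rows. Adding `2k` to the weight and `k` to the
    -- number of vertices turns the inequality into: weight at most number of vertices plus one.
    refute-sound : ∀ is {rows} k → T (refute is rows k) → Sound rows → All (Double is ∘ proj₁) rows →
                   total rows + k ≤ suc (length rows)
    -- `seen` collects the rows known not to be doubles of type `i`. Once all rows are there, the
    -- type does not occur and the remaining types take over.
    doubles-sound : ∀ i is seen rows k → T (doubles i is seen rows k) → T (refute is (seen ʳ++ rows) k) →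
                    All (λ r → ¬ (i ∈ c (proj₁ r) × next i ∈ c (proj₁ r))) seen →
                    Sound (seen ʳ++ rows) → All (Double (i ∷ is) ∘ proj₁) (seen ʳ++ rows) →
                    total (seen ʳ++ rows) + k ≤ suc (length (seen ʳ++ rows))

    refute-sound [] {rows} zero ok snd ds rewrite +-identityʳ (total rows) =
      m≤n⇒m≤1+n (total-singles (All.map (λ { (inj₁ s) → s ; (inj₂ (_ , () , _)) }) ds))
    refute-sound [] {rows} (suc zero) ok snd ds rewrite +-comm (total rows) 1 =
      s≤s (total-singles (All.map (λ { (inj₁ s) → s ; (inj₂ (_ , () , _)) }) ds))
    refute-sound [] {rows} (suc (suc u)) ok snd ds
      rewrite +-suc (total rows) (suc u) | +-suc (total rows) u =
      s≤s (refuteSingles-sound (length rows) u ok snd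
            (All.map (λ { (inj₁ s) → s ; (inj₂ (_ , () , _)) }) ds))
    refute-sound (i ∷ is) {rows} k ok snd ds =
      doubles-sound i is [] rows k (proj₁ (∧-T ok)) (proj₂ (∧-T ok)) [] snd ds

    doubles-sound i is seen [] k _ ok none snd ds =
      refute-sound is k ok snd
        (All.zipWith (λ (d , n) → drop-type d n)
          (ds , All-resp-↭ (↭-trans (↭.↭-reflexive (sym (List.++-identityʳ seen))) (++↭ʳ++ seen [])) none))
    doubles-sound i is seen ((v , L) ∷ rows) k ok ok′ none snd ds = case both of λ
        { (no ¬d)   → doubles-sound i is ((v , L) ∷ seen) rows k (proj₂ (∧-T ok)) ok′ (¬d ∷ none) snd ds
        ; (yes (i∈v , ni∈v)) → picked i∈v ni∈v }
      where
      both = (i ∈? c v) ×-dec (next i ∈? c v)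

      rest : List Row
      rest = seen ʳ++ rows

      front : seen ʳ++ ((v , L) ∷ rows) ↭ (v , L) ∷ rest
      front = ↭-trans (↭-sym (++↭ʳ++ seen _))
             (↭-trans (shift (v , L) seen rows) (↭.prep (v , L) (++↭ʳ++ seen rows)))

      picked : i ∈ c v → next i ∈ c v →
               total (seen ʳ++ ((v , L) ∷ rows)) + k ≤ suc (length (seen ʳ++ ((v , L) ∷ rows)))
      picked i∈v ni∈v with Sound-↭ front snd | All-resp-↭ front ds
      ... | sound (f ∷ fs) (l ∷ ls) | d ∷ ds′ = begin
        total (seen ʳ++ ((v , L) ∷ rows)) + k ≡⟨ cong (_+ k) (total-↭ front) ⟩
        -- Of the two units of the double, one raises `k` and the other is matched by the row taken
        -- out.
        ∣ c v ∣ + total rest + k              ≤⟨ +-monoˡ-≤ k (+-monoˡ-≤ (total rest) (size d)) ⟩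
        2 + (total rest + k)                  ≡⟨ cong suc (+-suc (total rest) k) ⟨
        suc (total rest + suc k)              ≡⟨ cong (λ z → suc (z + suc k)) total-rest′ ⟨
        suc (total rest′ + suc k)             ≤⟨ s≤s ih ⟩
        suc (suc (length rest′))              ≡⟨ cong (2 +_) length-rest′ ⟩
        suc (suc (length rest))               ≡⟨ cong suc (↭-length front) ⟨
        suc (length (seen ʳ++ ((v , L) ∷ rows))) ∎
        where
        open ≤-Reasoning
        rest′ : List Row
        rest′ = restrict v (next i) (restrict v i rest)

        size : Double (i ∷ is) v → ∣ c v ∣ ≤ 2
        size (inj₁ s)                   = m≤n⇒m≤1+n s
        size (inj₂ (_ , _ , _ , _ , s)) = s

        total-rest′ : total rest′ ≡ total rest
        total-rest′ = trans (total-restrict v (next i) (restrict v i rest)) (total-restrict v i rest)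

        length-rest′ : length rest′ ≡ length rest
        length-rest′ = trans (List.length-map _ (restrict v i rest)) (List.length-map _ rest)

        ih = refute-sound is (suc k)
               (not∨-T (cong₂ _∧_ ([]=⇒lookup (f i∈v)) ([]=⇒lookup (f ni∈v))) (proj₁ (∧-T ok)))
               (restrict-sound (next i) ni∈v (restrict-all v i l) (restrict-sound i i∈v l (sound fs ls)))
               (restrict-all v (next i) (restrict-all v i
                 (All.zipWith (λ (d , l) → drop-type d (λ (p , q) → type-unique l i∈v ni∈v p q)) (ds′ , l))))

    check-sound : ∀ vs → T (check vs) → AllPairs Linked vs →
                  (∀ v → ∣ c v ∣ ≤ 1 ⊎ ∃ λ i → i ∈ c v × next i ∈ c v × ∣ c v ∣ ≤ 2) →
                  sum (map (∣_∣ ∘ c) vs) ≤ suc (length vs)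
    check-sound vs ok ls shape = begin
      sum (map (∣_∣ ∘ c) vs)           ≡⟨ cong sum (List.map-∘ vs) ⟩
      total (map (_, ⊤) vs)            ≡⟨ +-identityʳ _ ⟨
      total (map (_, ⊤) vs) + 0        ≤⟨ refute-sound (allFin 5) 0 ok
                                            (sound (All.map⁺ (All.universal (λ v {_} _ → ∈⊤) vs)) (AllPairs.map⁺ ls))
                                            (All.universal (typed ∘ shape ∘ proj₁) _) ⟩
      suc (length (map (_, ⊤) vs))     ≡⟨ cong suc (List.length-map _ vs) ⟩
      suc (length vs)                  ∎
      where
      open ≤-Reasoning
      typed : ∀ {v} → ∣ c v ∣ ≤ 1 ⊎ (∃ λ i → i ∈ c v × next i ∈ c v × ∣ c v ∣ ≤ 2) →
              Double (allFin 5) v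
      typed (inj₁ s)       = inj₁ s
      typed (inj₂ (i , p)) = inj₂ (i , ∈-allFin i , p)

-- The tournament

-- As −1 is a non-residue modulo 11, it suffices to give the arcs between x < y.
residue : ℕ → Bool
residue d = (d ≡ᵇ 1) ∨ (d ≡ᵇ 3) ∨ (d ≡ᵇ 4) ∨ (d ≡ᵇ 5) ∨ (d ≡ᵇ 9)

-- The core vertices dominated by a chain vertex of parity `e`: 0 to 4 for `e = 0`, 1 to 5 for
-- `e = 1`.
window : ℕ → ℕ → Bool
window e b = (e ≤ᵇ b) ∧ (b <ᵇ 5 + e)

upward : ℕ → ℕ → Bool
upward x y = if y <ᵇ 11 then residue (y ∸ x) else
             if x <ᵇ 11 then not (window (y % 2) x) else true

<ᵇ-true : ∀ {m n} → m < n → (m <ᵇ n) ≡ true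
<ᵇ-true {m} {n} m<n with m <ᵇ n | <⇒<ᵇ m<n
... | true | _ = refl

<ᵇ-false : ∀ {m n} → n ≤ m → (m <ᵇ n) ≡ false
<ᵇ-false {m} {n} n≤m with m <ᵇ n in eq
... | true  = contradiction (<ᵇ⇒< m n (subst T (sym eq) tt)) (≤⇒≯ n≤m)
... | false = refl

opaque
  -- Opaque, so that general proofs rewrite with the three equations that follow; only the finite
  -- checks unfold it.
  arc : ℕ → ℕ → Bool
  arc x y = if x <ᵇ y then upward x y else if y <ᵇ x then not (upward y x) else false

  arc-< : ∀ {x y} → x < y → arc x y ≡ upward x y
  arc-< x<y rewrite <ᵇ-true x<y = refl

  arc-> : ∀ {x y} → y < x → arc x y ≡ not (upward y x)
  arc-> y<x rewrite <ᵇ-false (<⇒≤ y<x) | <ᵇ-true y<x = refl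

  arc-irrefl : ∀ x → arc x x ≡ false
  arc-irrefl x rewrite <ᵇ-false {x} ≤-refl = refl

T-not-total : ∀ b → T b ⊎ T (not b)
T-not-total true  = inj₁ tt
T-not-total false = inj₂ tt

T-not-asym : ∀ b → T b → ¬ T (not b)
T-not-asym true _ ()

arc-total : ∀ {x y} → x ≢ y → T (arc x y) ⊎ T (arc y x)
arc-total {x} {y} x≢y with <-cmp x y
... | tri< x<y _ _ rewrite arc-< x<y | arc-> x<y = T-not-total (upward x y)
... | tri≈ _ x≡y _ = contradiction x≡y x≢y
... | tri> _ _ y<x rewrite arc-< y<x | arc-> y<x = Sum.swap (T-not-total (upward y x))

arc-asym : ∀ {x y} → T (arc x y) → ¬ T (arc y x)
arc-asym {x} {y} x→y y→x with <-cmp x y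
... | tri< x<y _ _ rewrite arc-< x<y | arc-> x<y = T-not-asym _ x→y y→x
... | tri≈ _ refl _ rewrite arc-irrefl x = x→y
... | tri> _ _ y<x rewrite arc-< y<x | arc-> y<x = T-not-asym _ y→x x→y

arc-core-chain : ∀ {b z} → b < 11 → 11 ≤ z → arc b z ≡ not (window (z % 2) b)
arc-core-chain b< z≥ rewrite arc-< (<-≤-trans b< z≥) | <ᵇ-false z≥ | <ᵇ-true b< = refl

arc-chain-core : ∀ {b z} → b < 11 → 11 ≤ z → arc z b ≡ not (not (window (z % 2) b))
arc-chain-core b< z≥ rewrite arc-> (<-≤-trans b< z≥) | <ᵇ-false z≥ | <ᵇ-true b< = refl

arc-chain : ∀ {y z} → 11 ≤ y → y < z → T (arc y z)
arc-chain y≥ y<z rewrite arc-< y<z | <ᵇ-false (≤-trans y≥ (<⇒≤ y<z)) | <ᵇ-false y≥ = tt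

-- 2-paths and common neighbours in the tournament

any-Fin : ∀ {n} (p : Fin n → Bool) → T (any p (allFin n)) → ∃ λ i → T (p i)
any-Fin p ok = satisfied (any⁻ p (allFin _) ok)

unless : ∀ {A : Set} (a? : Dec A) {b} → ¬ A → T (does a? ∨ b) → T b
unless (yes a) ¬a _ = contradiction a ¬a
unless (no  _) ¬a t = t

viaᵇ commonᵇ : Fin 13 → Fin 13 → Fin 11 → Bool
viaᵇ x y b    = arc (toℕ x) (toℕ b) ∧ arc (toℕ b) (toℕ y)
commonᵇ x y b = (arc (toℕ x) (toℕ b) ∧ arc (toℕ y) (toℕ b)) ∨
                (arc (toℕ b) (toℕ x) ∧ arc (toℕ b) (toℕ y))

pairwise : ∀ {n} (p : Fin n → Fin n → Bool) → T (all (λ x → all (p x) (allFin n)) (allFin n)) →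
           ∀ x y → T (p x y)
pairwise p ok x = all-Fin (p x) (all-Fin (λ x → all (p x) (allFin _)) ok x)

opaque
  unfolding arc

  -- The thirteen vertices are the core and one chain vertex of each parity, 11 and 12. They
  -- represent all vertices because the intermediate vertex is sought in the core.
  core-via-check : T (all (λ x → all (λ y → does (x Fin.≟ y) ∨ any (viaᵇ x y) (allFin 11)) (allFin 13)) (allFin 13))
  core-via-check = tt

  core-common-check : T (all (λ x → all (λ y → any (commonᵇ x y) (allFin 11)) (allFin 13)) (allFin 13))
  core-common-check = tt

  core-path : ∀ (x y : Fin 13) → x ≢ y →
              ∃ λ (b : Fin 11) → T (arc (toℕ x) (toℕ b)) × T (arc (toℕ b) (toℕ y))
  core-path x y x≢y = Product.map₂ (λ {b} → ∧-T {arc (toℕ x) (toℕ b)} {arc (toℕ b) (toℕ y)})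
    (any-Fin (viaᵇ x y) (unless (x Fin.≟ y) {any (viaᵇ x y) (allFin 11)} x≢y
      (pairwise (λ x y → does (x Fin.≟ y) ∨ any (viaᵇ x y) (allFin 11)) core-via-check x y)))

  core-common : ∀ (x y : Fin 13) → ∃ λ (b : Fin 11) →
                (T (arc (toℕ x) (toℕ b)) × T (arc (toℕ y) (toℕ b))) ⊎
                (T (arc (toℕ b) (toℕ x)) × T (arc (toℕ b) (toℕ y)))
  core-common x y = Product.map₂
    (λ {b} → Sum.map (∧-T {arc (toℕ x) (toℕ b)} {arc (toℕ y) (toℕ b)})
                     (∧-T {arc (toℕ b) (toℕ x)} {arc (toℕ b) (toℕ y)})
           ∘ ∨-T {arc (toℕ x) (toℕ b) ∧ arc (toℕ y) (toℕ b)})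
    (any-Fin (commonᵇ x y) (pairwise (λ x y → any (commonᵇ x y) (allFin 11)) core-common-check x y))

-- Arcs between a vertex and the core ℤ/11 depend only on its kind: itself in the core, its parity in the chain.
record Kind (x : ℕ) : Set where
  field
    kind     : Fin 13
    arc-to   : ∀ (b : Fin 11) → arc x (toℕ b) ≡ arc (toℕ kind) (toℕ b)
    arc-from : ∀ (b : Fin 11) → arc (toℕ b) x ≡ arc (toℕ b) (toℕ kind)
    core     : x < 11 → x ≡ toℕ kind
    chain    : 11 ≤ x → 11 ≤ toℕ kind × x % 2 ≡ toℕ kind % 2
open Kind

chain-kind : ∀ {z} (κ : Fin 13) → 11 ≤ z → 11 ≤ toℕ κ → z % 2 ≡ toℕ κ % 2 → Kind z
chain-kind {z} κ z≥ κ≥ same = record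
  { kind     = κ
  ; arc-to   = λ b → trans (arc-chain-core (toℕ<n b) z≥)
                    (trans (cong (λ e → not (not (window e (toℕ b)))) same)
                           (sym (arc-chain-core (toℕ<n b) κ≥)))
  ; arc-from = λ b → trans (arc-core-chain (toℕ<n b) z≥)
                    (trans (cong (λ e → not (window e (toℕ b))) same)
                           (sym (arc-core-chain (toℕ<n b) κ≥)))
  ; core     = λ z<11 → contradiction z≥ (<⇒≱ z<11)
  ; chain    = λ _ → κ≥ , same
  }

kindOf : ∀ x → Kind x
kindOf x with x <? 11
... | yes x<11 = record
  { kind     = fromℕ< x<13
  ; arc-to   = λ b → cong (λ z → arc z (toℕ b)) x≡κ
  ; arc-from = λ b → cong (arc (toℕ b)) x≡κ
  ; core     = λ _ → x≡κ
  ; chain    = λ x≥11 → contradiction x≥11 (<⇒≱ x<11)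
  }
  where
  x<13 : x < 13
  x<13 = ≤-trans x<11 (m≤m+n 11 2)
  x≡κ : x ≡ toℕ (fromℕ< x<13)
  x≡κ = sym (toℕ-fromℕ< x<13)
... | no x≮11 with x % 2 in eq | m%n<n x 2
...   | 0           | _            = chain-kind (# 12) (≮⇒≥ x≮11) (m≤m+n 11 1) eq
...   | 1           | _            = chain-kind (# 11) (≮⇒≥ x≮11) ≤-refl eq
...   | suc (suc _) | s≤s (s≤s ())

same-kind : ∀ {x y} (κx : Kind x) (κy : Kind y) → kind κx ≡ kind κy →
            x ≡ y ⊎ (11 ≤ x × 11 ≤ y × x % 2 ≡ y % 2)
same-kind {x} {y} κx κy eq with x <? 11 | y <? 11
... | yes x< | yes y< = inj₁ (trans (core κx x<) (trans (cong toℕ eq) (sym (core κy y<))))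
... | yes x< | no  y≮ = contradiction (proj₁ (chain κy (≮⇒≥ y≮)))
                          (<⇒≱ (subst (_< 11) (trans (core κx x<) (cong toℕ eq)) x<))
... | no  x≮ | yes y< = contradiction (proj₁ (chain κx (≮⇒≥ x≮)))
                          (<⇒≱ (subst (_< 11) (trans (core κy y<) (cong toℕ (sym eq))) y<))
... | no  x≮ | no  y≮ = inj₂ (≮⇒≥ x≮ , ≮⇒≥ y≮ ,
  trans (proj₂ (chain κx (≮⇒≥ x≮))) (trans (cong (λ κ → toℕ κ % 2) eq) (sym (proj₂ (chain κy (≮⇒≥ y≮))))))

suc-%2 : ∀ x → x % 2 ≢ suc x % 2
suc-%2 0             ()
suc-%2 1             ()
suc-%2 (suc (suc x)) = suc-%2 x

module _ {m} (m≥15 : 15 ≤ m) where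

  core<m : ∀ (b : Fin 11) → toℕ b < m
  core<m b = <-≤-trans (toℕ<n b) (≤-trans (m≤m+n 11 4) m≥15)

  arc-via : ∀ {x y} → Kind x → Kind y → y < m → T (arc x y) →
            ∃ λ z → z < m × T (arc x z) × T (arc z y)
  arc-via {x} {y} κx κy y<m x→y with kind κx Fin.≟ kind κy
  ... | no  ≢ with b , x→b , b→y ← core-path _ _ ≢ =
    toℕ b , core<m b , subst T (sym (arc-to κx b)) x→b , subst T (sym (arc-from κy b)) b→y
  ... | yes eq with same-kind κx κy eq | <-cmp x y
  ...   | inj₁ refl             | _             = contradiction x→y (arc-asym x→y)
  ...   | inj₂ _                | tri≈ _ refl _ = contradiction x→y (arc-asym x→y)
  ...   | inj₂ (_ , y≥ , _)     | tri> _ _ y<x  = contradiction (arc-chain y≥ y<x) (arc-asym x→y)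
  -- Two chain vertices of equal parity are not consecutive, so `suc x` lies strictly between them.
  ...   | inj₂ (x≥ , y≥ , same) | tri< x<y _ _  =
    suc x , ≤-<-trans x<y y<m , arc-chain x≥ (n<1+n x) ,
    arc-chain (m≤n⇒m≤1+n x≥) (≤∧≢⇒< x<y λ 1+x≡y → suc-%2 x (trans same (cong (_% 2) (sym 1+x≡y))))

  arc-common : ∀ {x y} → Kind x → Kind y → ∃ λ z → z < m ×
               ((T (arc x z) × T (arc y z)) ⊎ (T (arc z x) × T (arc z y)))
  arc-common κx κy with b , common ← core-common (kind κx) (kind κy) = toℕ b , core<m b ,
    Sum.map (Product.map (subst T (sym (arc-to κx b))) (subst T (sym (arc-to κy b))))
            (Product.map (subst T (sym (arc-from κx b))) (subst T (sym (arc-from κy b)))) common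

-- Deleting two consecutive chain vertices

skip : ℕ → ℕ → ℕ
skip zero    x       = 2 + x
skip (suc p) zero    = zero
skip (suc p) (suc x) = suc (skip p x)

skip-< : ∀ p {x y} → x < y → skip p x < skip p y
skip-< zero    x<y                         = +-monoʳ-< 2 x<y
skip-< (suc p) {zero}  {suc y} _           = z<s
skip-< (suc p) {suc x} {suc y} (s≤s x<y)   = s≤s (skip-< p x<y)

skip-% : ∀ p x → skip p x % 2 ≡ x % 2
skip-% zero          x             = refl
skip-% (suc p)       zero          = refl
skip-% (suc zero)    (suc x)       = refl
skip-% (suc (suc p)) (suc zero)    = refl
skip-% (suc (suc p)) (suc (suc x)) = skip-% p x

skip-below : ∀ p {x} → x < p → skip p x ≡ x
skip-below (suc p) {zero}  _         = refl
skip-below (suc p) {suc x} (s≤s x<p) = cong suc (skip-below p x<p)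

skip-<ᵇ-below : ∀ k p x → k ≤ p → (skip p x <ᵇ k) ≡ (x <ᵇ k)
skip-<ᵇ-below zero    p       x       _         = refl
skip-<ᵇ-below (suc k) (suc p) zero    _         = refl
skip-<ᵇ-below (suc k) (suc p) (suc x) (s≤s k≤p) = skip-<ᵇ-below k p x k≤p

upward-skip : ∀ p {x y} → 11 ≤ p → x < y → upward (skip p x) (skip p y) ≡ upward x y
upward-skip p {x} {y} p≥ x<y rewrite skip-<ᵇ-below 11 p y p≥ | skip-<ᵇ-below 11 p x p≥ | skip-% p y
  with y <? 11 | x <? 11
... | yes y< | _      rewrite skip-below p (<-≤-trans y< p≥) | skip-below p (<-≤-trans (<-trans x<y y<) p≥) = refl
... | no  y≮ | yes x< rewrite <ᵇ-false (≮⇒≥ y≮) | skip-below p (<-≤-trans x< p≥) = refl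
... | no  y≮ | no  x≮ rewrite <ᵇ-false (≮⇒≥ y≮) | <ᵇ-false (≮⇒≥ x≮) = refl

-- `skip p` enumerates the numbers other than `p` and `p + 1`. It fixes the core and preserves order
-- and parity, on which the arcs at the chain depend.
arc-skip : ∀ p x y → 11 ≤ p → arc (skip p x) (skip p y) ≡ arc x y
arc-skip p x y p≥ with <-cmp x y
... | tri< x<y _ _  rewrite arc-< x<y | arc-< (skip-< p x<y) = upward-skip p p≥ x<y
... | tri≈ _ refl _ rewrite arc-irrefl x | arc-irrefl (skip p x) = refl
... | tri> _ _ y<x  rewrite arc-> y<x | arc-> (skip-< p y<x) = cong not (upward-skip p p≥ y<x)

sum-skip : ∀ (f : ℕ → ℕ) p r →
           sum (applyUpTo f (p + (2 + r))) ≡ f p + f (suc p) + sum (applyUpTo (f ∘ skip p) (p + r))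
sum-skip f zero    r = sym (+-assoc (f 0) (f 1) _)
sum-skip f (suc p) r = begin
  f 0 + sum (applyUpTo (f ∘ suc) (p + (2 + r)))         ≡⟨ cong (f 0 +_) (sum-skip (f ∘ suc) p r) ⟩
  f 0 + (f (suc p) + f (2 + p) + rest)                  ≡⟨ x∙yz≈y∙xz +-commutativeSemigroup (f 0) _ rest ⟩
  f (suc p) + f (2 + p) + (f 0 + rest)                  ∎
  where
  open ≡-Reasoning
  rest = sum (applyUpTo (f ∘ suc ∘ skip p) (p + r))

-- Independent sets as configurations of layers

open Search arc using (check; check-sound; type-unique)

-- The independent sets of the pentagon that joins `i` to `i + 2`, which is one column of the graph.
Apart : Subset 5 → Set
Apart s = ∀ i → i ∈ s → next (next i) ∉ s

Shape : Subset 5 → Set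
Shape s = ∣ s ∣ ≤ 1 ⊎ ∃ λ i → i ∈ s × next i ∈ s × ∣ s ∣ ≤ 2

opaque
  -- Checked for all 32 subsets: non-adjacent layers of the pentagon are cyclically consecutive, and
  -- no three are pairwise so.
  shape : ∀ s → Apart s → Shape s
  shape s apart = decidable-stable (shape? s) λ ¬shape → 
    toWitnessFalse {a? = anySubset? λ s → apart? s ×-dec ¬? (shape? s)} tt (s , apart , ¬shape)
    where
    apart? : ∀ s → Dec (Apart s)
    apart? s = all? λ i → i ∈? s →-dec ¬? (next (next i) ∈? s)
    shape? : ∀ s → Dec (Shape s)
    shape? s = ∣ s ∣ ≤? 1 ⊎-dec any? λ i → i ∈? s ×-dec next i ∈? s ×-dec ∣ s ∣ ≤? 2

-- An independent set read column by column: `c x` holds the layers in which `x` occurs. Indexing by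
-- all of ℕ lets vertices be deleted by composing with `skip`.
record Configuration (c : ℕ → Subset 5) : Set where
  field
    valid : ∀ x y → T (arc x y) → ∀ {i} → i ∈ c x → next i ∉ c y
    apart : ∀ x → Apart (c x)
open Configuration

weight : (ℕ → Subset 5) → ℕ → ℕ
weight c m = sum (applyUpTo (∣_∣ ∘ c) m)

opaque
  unfolding arc

  check15 : check (upTo 15) ≡ true
  check15 = refl

  check17 : check (upTo 17) ≡ true
  check17 = refl

  check19 : check (upTo 19) ≡ true
  check19 = refl

  check21 : check (upTo 21) ≡ true
  check21 = refl

checked : ∀ {c} m → check (upTo m) ≡ true → Configuration c → weight c m ≤ suc m
checked {c} m ok conf = begin
  weight c m                   ≡⟨ cong sum (List.map-upTo (∣_∣ ∘ c) m) ⟨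
  sum (map (∣_∣ ∘ c) (upTo m)) ≤⟨ check-sound c (valid conf) (upTo m) (subst T (sym ok) tt)
                                   (AllPairs.map arc-total (upTo⁺ m)) (λ v → shape (c v) (apart conf v)) ⟩
  suc (length (upTo m))        ≡⟨ cong suc (List.length-upTo m) ⟩
  suc m                        ∎
  where open ≤-Reasoning

SinglePair : (ℕ → Subset 5) → ℕ → Set
SinglePair c p = ∣ c p ∣ ≤ 1 × ∣ c (suc p) ∣ ≤ 1

opaque
  -- Six disjoint pairs, but only five types of doubles.
  single-pair : ∀ {c} → Configuration c → ∃ λ (j : Fin 6) → SinglePair c (11 + (toℕ j + toℕ j))
  single-pair {c} conf = decidable-stable (any? λ j → ∣ c _ ∣ ≤? 1 ×-dec ∣ c _ ∣ ≤? 1) λ none →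
    let open Double′ none in clash (pigeonhole ≤-refl type)
    where
    double : ∀ p → ¬ SinglePair c p → ∃ λ d → (p ≤ d × d ≤ suc p) × ∃ λ i → i ∈ c d × next i ∈ c d
    double p ¬single with shape (c p) (apart conf p) | shape (c (suc p)) (apart conf (suc p))
    ... | inj₁ s | inj₁ s′                = contradiction (s , s′) ¬single
    ... | inj₂ (i , i∈ , n∈ , _) | _      = p , (≤-refl , n≤1+n p) , i , i∈ , n∈
    ... | inj₁ _ | inj₂ (i , i∈ , n∈ , _) = suc p , (n≤1+n p , ≤-refl) , i , i∈ , n∈

    module Double′ (none : ¬ ∃ λ (j : Fin 6) → SinglePair c (11 + (toℕ j + toℕ j))) where
      at : ∀ j → _
      at j = double (11 + (toℕ j + toℕ j)) (λ s → none (j , s))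
      type : Fin 6 → Fin 5
      type j = proj₁ (proj₂ (proj₂ (at j)))
      clash : ¬ ∃ λ i → ∃ λ j → i Fin.< j × type i ≡ type j
      clash (i , j , i<j , same)
        with d , (_ , d≤) , τ , τ∈d , n∈d ← at i | e , (e≥ , _) , τ′ , τ′∈e , n∈e ← at j
        with refl ← same = type-unique c (valid conf) (arc-total (<⇒≢ d<e)) τ∈d n∈d τ′∈e n∈e
        where
        d<e : d < e
        d<e = ≤-trans (s≤s d≤) (≤-trans (+-monoʳ-≤ 11 (≤-trans
                (≤-reflexive (cong suc (sym (+-suc (toℕ i) (toℕ i))))) (+-mono-≤ i<j i<j))) e≥)

configuration-skip : ∀ {c p} → 11 ≤ p → Configuration c → Configuration (c ∘ skip p)
configuration-skip {c} {p} p≥ conf = record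
  { valid = λ x y x→y → valid conf _ _ (subst T (sym (arc-skip p x y p≥)) x→y)
  ; apart = λ x → apart conf (skip p x)
  }

-- Two single vertices weigh at most 2, as much as the bound grows from `m` to `2 + m`.
weight-skip : ∀ {c m} p → p ≤ m → SinglePair c p → weight (c ∘ skip p) m ≤ suc m → weight c (2 + m) ≤ 3 + m
weight-skip {c} {m} p p≤m (s , s′) bound = begin
  weight c (2 + m)                                       ≡⟨ cong (weight c) size ⟨
  weight c (p + (2 + r))                                 ≡⟨ sum-skip (∣_∣ ∘ c) p r ⟩
  ∣ c p ∣ + ∣ c (suc p) ∣ + weight (c ∘ skip p) (p + r)  ≤⟨ +-monoˡ-≤ _ (+-mono-≤ s s′) ⟩
  2 + weight (c ∘ skip p) (p + r)                        ≡⟨ cong (λ m → 2 + weight (c ∘ skip p) m) (m+[n∸m]≡n p≤m) ⟩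
  2 + weight (c ∘ skip p) m                              ≤⟨ +-monoʳ-≤ 2 bound ⟩
  3 + m                                                  ∎
  where
  open ≤-Reasoning
  r : ℕ
  r = m ∸ p
  size : p + (2 + r) ≡ 2 + m
  size = trans (+-suc p (suc r)) (cong suc (trans (+-suc p r) (cong suc (m+[n∸m]≡n p≤m))))

WeightBound : ℕ → Set
WeightBound k = ∀ {c} → Configuration c → weight c (15 + (k + k)) ≤ suc (15 + (k + k))

weight-step : ∀ k → 3 ≤ k → WeightBound k → WeightBound (suc k)
weight-step k k≥3 bound {c} conf with j , single ← single-pair conf =
  subst (λ m → weight c m ≤ suc m) (cong (16 +_) (sym (+-suc k k)))
    (weight-skip {c = c} p p≤m single (bound (configuration-skip {p = p} (m≤m+n 11 _) conf)))
  where
  p : ℕ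
  p = 11 + (toℕ j + toℕ j)
  -- The last candidate pair is 21 and 22, so `2 + m` must be at least 23; this is `k ≥ 3`.
  p≤m : p ≤ 15 + (k + k)
  p≤m = ≤-trans (+-monoʳ-≤ 11 (+-mono-≤ j≤5 j≤5)) (+-monoʳ-≤ 15 (+-mono-≤ k≥3 k≥3))
    where j≤5 = s≤s⁻¹ (toℕ<n j)

weight-bound : ∀ k → WeightBound k
weight-bound 0 = checked 15 check15
weight-bound 1 = checked 17 check17
weight-bound 2 = checked 19 check19
weight-bound 3 = checked 21 check21
weight-bound (suc k@(suc (suc (suc l)))) = weight-step k (m≤m+n 3 l) (weight-bound k)

-- The graph

Step Match : Fin 5 → Fin 5 → Set
Step i j  = j ≡ next i
Match i j = j ≡ next (next i) ⊎ i ≡ next (next j)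

step? : ∀ i j → Dec (Step i j)
step? i j = j Fin.≟ next i

match? : ∀ i j → Dec (Match i j)
match? i j = (j Fin.≟ next (next i)) ⊎-dec (i Fin.≟ next (next j))

opaque
  match-irrefl : ∀ i → ¬ Match i i
  match-irrefl = toWitness {a? = all? λ i → ¬? (match? i i)} tt

  step-irrefl : ∀ i → ¬ Step i i
  step-irrefl = toWitness {a? = all? λ i → ¬? (step? i i)} tt

  step-asym : ∀ i j → Step i j → ¬ Step j i
  step-asym = toWitness {a? = all? λ i → all? λ j → step? i j →-dec ¬? (step? j i)} tt

  match-step : ∀ i j → Match i j → ¬ Step i j
  match-step = toWitness {a? = all? λ i → all? λ j → match? i j →-dec ¬? (step? i j)} tt

  match-triangle : ∀ i j k → Match i j → Match j k → ¬ Match i k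
  match-triangle = toWitness {a? = all? λ i → all? λ j → all? λ k →
    match? i j →-dec (match? j k →-dec ¬? (match? i k))} tt

  step-triangle : ∀ i j k → Step i j ⊎ Step j i → Step j k ⊎ Step k j → ¬ (Step i k ⊎ Step k i)
  step-triangle = toWitness {a? = all? λ i → all? λ j → all? λ k →
    (step? i j ⊎-dec step? j i) →-dec ((step? j k ⊎-dec step? k j) →-dec ¬? (step? i k ⊎-dec step? k i))} tt

  next⁵ : ∀ i → next (next (next (next (next i)))) ≡ i
  next⁵ = toWitness {a? = all? λ i → next (next (next (next (next i)))) Fin.≟ i} tt

  layer-cases : ∀ i j → i ≡ j ⊎ (Step i j ⊎ Step j i) ⊎ Match i j
  layer-cases = toWitness {a? = all? λ i → all? λ j →
    (i Fin.≟ j) ⊎-dec ((step? i j ⊎-dec step? j i) ⊎-dec match? i j)} tt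

match-sym : ∀ {i j} → Match i j → Match j i
match-sym = Sum.swap

∣++∣ : ∀ {k n} (p : Subset k) (q : Subset n) → ∣ p ++ q ∣ ≡ ∣ p ∣ + ∣ q ∣
∣++∣ []          q = refl
∣++∣ (true ∷ p)  q = cong suc (∣++∣ p q)
∣++∣ (false ∷ p) q = ∣++∣ p q

-- Column `x` is the `x`-th block of five entries, in accordance with `combine`; columns from `m` on
-- are empty.
row : ∀ m → Subset (m * 5) → ℕ → Subset 5
row zero    S                           x       = ⊥
row (suc m) (a ∷ b ∷ c ∷ d ∷ e ∷ S) zero    = a ∷ b ∷ c ∷ d ∷ e ∷ []
row (suc m) (a ∷ b ∷ c ∷ d ∷ e ∷ S) (suc x) = row m S x

∈-row : ∀ m S {x i} → i ∈ row m S x → ∃ λ (y : Fin m) → x ≡ toℕ y × combine y i ∈ S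
∈-row zero    S {x}     i∈ = contradiction i∈ ∉⊥
∈-row (suc m) (a ∷ b ∷ c ∷ d ∷ e ∷ S) {zero}  {i} i∈ = zero , refl ,
  lookup⇒[]= _ _ (trans (lookup-++ˡ (a ∷ b ∷ c ∷ d ∷ e ∷ []) S i) ([]=⇒lookup i∈))
∈-row (suc m) (a ∷ b ∷ c ∷ d ∷ e ∷ S) {suc x} {i} i∈ with y , eq , yi∈ ← ∈-row m S i∈ = suc y , cong suc eq ,
  lookup⇒[]= _ _ (trans (lookup-++ʳ (a ∷ b ∷ c ∷ d ∷ e ∷ []) S (combine y i)) ([]=⇒lookup yi∈))

∣rows∣ : ∀ m S → weight (row m S) m ≡ ∣ S ∣
∣rows∣ zero    []                          = refl
∣rows∣ (suc m) (a ∷ b ∷ c ∷ d ∷ e ∷ S) =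
  trans (cong (∣ a ∷ b ∷ c ∷ d ∷ e ∷ [] ∣ +_) (∣rows∣ m S)) (sym (∣++∣ (a ∷ b ∷ c ∷ d ∷ e ∷ []) S))

∣concat-singletons∣ : ∀ {m} (ℓ : Fin m → Fin 5) → ∣ concat (tabulate (⁅_⁆ ∘ ℓ)) ∣ ≡ m
∣concat-singletons∣ {zero}  ℓ = refl
∣concat-singletons∣ {suc m} ℓ =
  trans (∣++∣ ⁅ ℓ zero ⁆ _) (cong₂ _+_ (∣⁅x⁆∣≡1 (ℓ zero)) (∣concat-singletons∣ (ℓ ∘ suc)))

module Construction (m : ℕ) (m≥15 : 15 ≤ m) (bound : ∀ {c} → Configuration c → weight c m ≤ suc m) where

  infix 4 _⟶_ _⟶?_
  _⟶_ : Fin m → Fin m → Set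
  x ⟶ y = T (arc (toℕ x) (toℕ y))

  _⟶?_ : ∀ x y → Dec (x ⟶ y)
  x ⟶? y = T? _

  ⟶-asym : ∀ {x y} → x ⟶ y → ¬ y ⟶ x
  ⟶-asym {x} {y} = arc-asym {toℕ x} {toℕ y}

  ⟶-irrefl : ∀ {x} → ¬ x ⟶ x
  ⟶-irrefl x⟶x = ⟶-asym x⟶x x⟶x

  ⟶-total : ∀ {x y} → x ≢ y → x ⟶ y ⊎ y ⟶ x
  ⟶-total x≢y = arc-total (x≢y ∘ toℕ-injective)

  opaque
    ⟶-via : ∀ {x y} → x ⟶ y → ∃ λ z → x ⟶ z × z ⟶ y
    ⟶-via {x} {y} x⟶y with z , z<m , p , q ← arc-via m≥15 (kindOf (toℕ x)) (kindOf (toℕ y)) (toℕ<n y) x⟶y =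
      fromℕ< z<m , subst (T ∘ arc (toℕ x)) (sym (toℕ-fromℕ< z<m)) p
                 , subst (λ z → T (arc z (toℕ y))) (sym (toℕ-fromℕ< z<m)) q

    ⟶-common : ∀ x y → ∃ λ z → (x ⟶ z × y ⟶ z) ⊎ (z ⟶ x × z ⟶ y)
    ⟶-common x y with z , z<m , common ← arc-common m≥15 (kindOf (toℕ x)) (kindOf (toℕ y)) =
      fromℕ< z<m , subst (λ z → (T (arc (toℕ x) z) × T (arc (toℕ y) z)) ⊎ (T (arc z (toℕ x)) × T (arc z (toℕ y))))
                     (sym (toℕ-fromℕ< z<m)) common

  -- Adjacency and absence of triangles

  Place : Set
  Place = Fin m × Fin 5

  Matched Arc Adj : Place → Place → Set
  Matched (x , i) (y , j) = x ≡ y × Match i j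
  Arc     (x , i) (y , j) = (x ⟶ y × Step i j) ⊎ (y ⟶ x × Step j i)
  Adj P Q = Matched P Q ⊎ Arc P Q

  adj? : ∀ P Q → Dec (Adj P Q)
  adj? (x , i) (y , j) = (x Fin.≟ y ×-dec match? i j) ⊎-dec
                         ((x ⟶? y ×-dec step? i j) ⊎-dec (y ⟶? x ×-dec step? j i))

  matched-sym : ∀ {P Q} → Matched P Q → Matched Q P
  matched-sym (refl , m) = refl , match-sym m

  arc-sym : ∀ {P Q} → Arc P Q → Arc Q P
  arc-sym = Sum.swap

  adj-sym : ∀ {P Q} → Adj P Q → Adj Q P
  adj-sym {P} {Q} = Sum.map (matched-sym {P} {Q}) (arc-sym {P} {Q})

  adj-same : ∀ {x y i} → ¬ Adj (x , i) (y , i)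
  adj-same (inj₁ (_ , m))        = match-irrefl _ m
  adj-same (inj₂ (inj₁ (_ , s))) = step-irrefl _ s
  adj-same (inj₂ (inj₂ (_ , s))) = step-irrefl _ s

  adj-match : ∀ {x y i j} → Match i j → Adj (x , i) (y , j) → x ≡ y
  adj-match m (inj₁ (x≡y , _))      = x≡y
  adj-match m (inj₂ (inj₁ (_ , s))) = contradiction s (match-step _ _ m)
  adj-match m (inj₂ (inj₂ (_ , s))) = contradiction s (match-step _ _ (match-sym m))

  adj-step : ∀ {x y i j} → Step i j → Adj (x , i) (y , j) → x ⟶ y
  adj-step s (inj₁ (_ , m))         = contradiction s (match-step _ _ m)
  adj-step s (inj₂ (inj₁ (a , _)))  = a
  adj-step s (inj₂ (inj₂ (_ , s′))) = contradiction s′ (step-asym _ _ s)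

  no-matched-arc : ∀ {P Q R} → Matched P Q → Matched Q R → ¬ Arc P R
  no-matched-arc (refl , _) (refl , _) (inj₁ (a , _)) = ⟶-irrefl a
  no-matched-arc (refl , _) (refl , _) (inj₂ (a , _)) = ⟶-irrefl a

  -- Arcs between the same two columns have one direction, so the layer of `R` determines the layer
  -- at the other end, and `P` and `Q` would coincide.
  no-arcs-matched : ∀ {P Q R} → Matched P Q → Arc Q R → ¬ Arc P R
  no-arcs-matched (refl , m) (inj₁ (a , s))    (inj₂ (b , _))    = ⟶-asym a b
  no-arcs-matched (refl , m) (inj₂ (a , _))    (inj₁ (b , _))    = ⟶-asym a b
  no-arcs-matched (refl , m) (inj₂ (_ , refl)) (inj₂ (_ , refl)) = match-irrefl _ m
  no-arcs-matched {_ , i} {_ , j} (refl , m) (inj₁ (_ , refl)) (inj₁ (_ , s)) =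
    match-irrefl i (subst (Match i) (sym (next-injective s)) m)
    where
    next-injective : ∀ {i j} → next j ≡ next i → i ≡ j
    next-injective {i} {j} eq =
      trans (sym (next⁵ i)) (trans (cong (next ∘ next ∘ next ∘ next) (sym eq)) (next⁵ j))

  -- Each arc changes the layer by 1 or -1, and three such changes never add up to 0 modulo 5.
  no-arcs : ∀ {P Q R} → Arc P Q → Arc Q R → ¬ Arc P R
  no-arcs a b c = step-triangle _ _ _ (steps a) (steps b) (steps c)
    where
    steps : ∀ {x i y j} → Arc (x , i) (y , j) → Step i j ⊎ Step j i
    steps = Sum.map proj₂ proj₂

  no-triangle : ∀ P Q R → Adj P Q → Adj Q R → ¬ Adj P R
  no-triangle P Q R (inj₁ a) (inj₁ b) (inj₁ c) = match-triangle _ _ _ (proj₂ a) (proj₂ b) (proj₂ c)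
  no-triangle P Q R (inj₁ a) (inj₁ b) (inj₂ c) = no-matched-arc a b c
  no-triangle P Q R (inj₁ a) (inj₂ b) (inj₁ c) = no-matched-arc (matched-sym {P} {Q} a) c b
  no-triangle P Q R (inj₂ a) (inj₁ b) (inj₁ c) = no-matched-arc c (matched-sym {Q} {R} b) a
  no-triangle P Q R (inj₁ a) (inj₂ b) (inj₂ c) = no-arcs-matched a b c
  no-triangle P Q R (inj₂ a) (inj₁ b) (inj₂ c) = no-arcs-matched b (arc-sym {P} {R} c) (arc-sym {P} {Q} a)
  no-triangle P Q R (inj₂ a) (inj₂ b) (inj₁ c) = no-arcs-matched c (arc-sym {Q} {R} b) a
  no-triangle P Q R (inj₂ a) (inj₂ b) (inj₂ c) = no-arcs a b c

  -- Maximality: common neighbours of non-adjacent places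

  CommonNeighbour : Place → Place → Set
  CommonNeighbour P Q = ∃ λ R → Adj P R × Adj Q R

  -- In one column, layer `i + 3` is matched with both. Otherwise `y ⟶ x`, and `(y , i + 1)` is
  -- joined to `(x , i + 2)`, which is matched with `(x , i)`.
  common-step : ∀ x y i → ¬ x ⟶ y → CommonNeighbour (x , i) (y , next i)
  common-step x y i ¬x⟶y with x Fin.≟ y
  ... | yes refl = (x , next (next (next i))) , inj₁ (refl , inj₂ (sym (next⁵ i))) , inj₁ (refl , inj₁ refl)
  ... | no  x≢y with ⟶-total x≢y
  ...   | inj₁ x⟶y = contradiction x⟶y ¬x⟶y
  ...   | inj₂ y⟶x = (x , next (next i)) , inj₁ (refl , inj₁ refl) , inj₂ (inj₁ (y⟶x , refl))

  -- If `x ⟶ y`, a 2-path of the tournament climbs through layer `i + 1`. If `y ⟶ x`, the place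
  -- `(y , i + 4)` is one step before `(x , i)` and matched with `(y , i + 2)`.
  common-match : ∀ x y i → x ≢ y → CommonNeighbour (x , i) (y , next (next i))
  common-match x y i x≢y with ⟶-total x≢y
  ... | inj₁ x⟶y = let z , x⟶z , z⟶y = ⟶-via x⟶y in
    (z , next i) , inj₂ (inj₁ (x⟶z , refl)) , inj₂ (inj₂ (z⟶y , refl))
  ... | inj₂ y⟶x = (y , next (next (next (next i)))) , inj₂ (inj₂ (y⟶x , sym (next⁵ i))) , inj₁ (refl , inj₁ refl)

  common-same : ∀ x y i → CommonNeighbour (x , i) (y , i)
  common-same x y i with ⟶-common x y
  ... | z , inj₁ (x⟶z , y⟶z) = (z , next i) , inj₂ (inj₁ (x⟶z , refl)) , inj₂ (inj₁ (y⟶z , refl))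
  ... | z , inj₂ (z⟶x , z⟶y) =
    (z , prev i) , inj₂ (inj₂ (z⟶x , sym (next-prev i))) , inj₂ (inj₂ (z⟶y , sym (next-prev i)))

  common-neighbour : ∀ P Q → ¬ Adj P Q → CommonNeighbour P Q
  common-neighbour (x , i) (y , j) ¬adj with layer-cases i j
  ... | inj₁ refl                       = common-same x y i
  ... | inj₂ (inj₁ (inj₁ refl))         = common-step x y i λ x⟶y → ¬adj (inj₂ (inj₁ (x⟶y , refl)))
  ... | inj₂ (inj₁ (inj₂ refl))         = Product.map₂ Product.swap (common-step y x j λ y⟶x → ¬adj (inj₂ (inj₂ (y⟶x , refl))))
  ... | inj₂ (inj₂ m@(inj₁ refl))       = common-match x y i λ x≡y → ¬adj (inj₁ (x≡y , m))
  ... | inj₂ (inj₂ m@(inj₂ refl))       = Product.map₂ Product.swap (common-match y x j λ y≡x → ¬adj (inj₁ (sym y≡x , m)))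

  place : Fin (m * 5) → Place
  place = remQuot 5

  place-combine : ∀ x i → place (combine x i) ≡ (x , i)
  place-combine = remQuot-combine {m} {5}

  place-injective : ∀ {a b} → place a ≡ place b → a ≡ b
  place-injective {a} {b} eq = trans (sym (combine-remQuot {m} 5 a))
    (trans (cong (λ (x , i) → combine x i) eq) (combine-remQuot {m} 5 b))

  G : Graph (m * 5)
  G = record
    { _~_      = λ a b → Adj (place a) (place b)
    ; _~?_     = λ a b → adj? (place a) (place b)
    ; ~-sym    = λ {a} {b} → adj-sym {place a} {place b}
    ; ~-irrefl = λ { refl → adj-same }
    }
  open Graph G

  triangle-free : ¬ Triangle G
  triangle-free (a , b , c , ab , bc , ac) = no-triangle (place a) (place b) (place c) ab bc ac

  -- The columns of an independent set form a configuration whose weight is the size of the set, so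
  -- `bound` applies.
  no-large-independent : ¬ ∃ λ S → ∣ S ∣ ≡ 2 + m × IsIndependent G S
  no-large-independent (S , size , ind) = <-irrefl refl (subst (_≤ suc m) (trans (∣rows∣ m S) size) (bound record
    { valid = λ x y x→y i∈x ni∈y → let x′ , ex , x∈S = ∈-row m S i∈x ; y′ , ey , y∈S = ∈-row m S ni∈y in
        ind x∈S y∈S (at x′ _ y′ _ (inj₂ (inj₁ (subst₂ (λ x y → T (arc x y)) ex ey x→y , refl))))
    ; apart = λ x i i∈x nni∈x → let x′ , ex , x∈S = ∈-row m S i∈x ; y′ , ey , y∈S = ∈-row m S nni∈x in
        ind x∈S y∈S (at x′ _ y′ _ (inj₁ (toℕ-injective (trans (sym ex) ey) , inj₁ refl)))
    }))
    where
    at : ∀ x i y j → Adj (x , i) (y , j) → combine x i ~ combine y j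
    at x i y j = subst₂ Adj (sym (place-combine x i)) (sym (place-combine y j))

  add-breaks : ∀ {u v} (u≢v : u ≢ v) → ¬ u ~ v → ¬ RamseyGood 3 (2 + m) (addEdge G u v u≢v)
  add-breaks {u} {v} u≢v u≁v (no-clique , _) with (z , k) , uz , vz ← common-neighbour (place u) (place v) u≁v =
    no-clique (triangle⇒clique (addEdge G u v u≢v)
      (u , v , combine z k , inj₂ (inj₁ (refl , refl)) , inj₁ (at v vz) , inj₁ (at u uz)))
    where
    at : ∀ a → Adj (place a) (z , k) → a ~ combine z k
    at a = subst (Adj (place a)) (sym (place-combine z k))

  -- Criticality of every edge

  Breaks : Place → Place → Set
  Breaks E F = ∀ {e f} → place e ≡ E → place f ≡ F → ¬ RamseyGood 3 (2 + m) (deleteEdge G e f)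

  -- A transversal ℓ of the columns together with two further places has 2 + m elements.
  module Breaking (A : Place → Set) (ℓ : Fin m → Fin 5) (P Q : Place)
                  (P∉ℓ : proj₂ P ≢ ℓ (proj₁ P)) (Q∉ℓ : proj₂ Q ≢ ℓ (proj₁ Q)) (P≢Q : P ≢ Q)
                  (Aℓ : ∀ x → A (x , ℓ x)) (AP : A P) (AQ : A Q) where

    p q : Fin (m * 5)
    p = combine (proj₁ P) (proj₂ P)
    q = combine (proj₁ Q) (proj₂ Q)

    base S : Subset (m * 5)
    base = concat (tabulate (⁅_⁆ ∘ ℓ))
    S    = base ∪ (⁅ p ⁆ ∪ ⁅ q ⁆)

    ∈-base : ∀ {a} → a ∈ base → proj₂ (place a) ≡ ℓ (proj₁ (place a))
    ∈-base {a} a∈ = x∈⁅y⁆⇒x≡y (ℓ x) (lookup⇒[]= i ⁅ ℓ x ⁆ (trans (sym looked) ([]=⇒lookup a∈)))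
      where
      x = proj₁ (place a)
      i = proj₂ (place a)
      looked : lookup base a ≡ lookup ⁅ ℓ x ⁆ i
      looked = trans (cong (lookup base) (sym (combine-remQuot {m} 5 a)))
              (trans (lookup-concat (tabulate (⁅_⁆ ∘ ℓ)) x i) (cong (λ r → lookup r i) (lookup∘tabulate (⁅_⁆ ∘ ℓ) x)))

    place-p : place p ≡ P
    place-p = place-combine _ _
    place-q : place q ≡ Q
    place-q = place-combine _ _

    off-base : ∀ {a R} → place a ≡ R → proj₂ R ≢ ℓ (proj₁ R) → a ∉ base
    off-base refl R∉ a∈ = R∉ (∈-base a∈)

    size : ∣ S ∣ ≡ 2 + m
    size = trans (disjoint-∣∪∣ base (⁅ p ⁆ ∪ ⁅ q ⁆) λ a∈ →
                   Sum.[ off p place-p P∉ℓ a∈ , off q place-q Q∉ℓ a∈ ] ∘ x∈p∪q⁻ ⁅ p ⁆ ⁅ q ⁆)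
          (trans (cong₂ _+_ (∣concat-singletons∣ ℓ)
                   (trans (disjoint-∣∪∣ ⁅ p ⁆ ⁅ q ⁆ λ a∈p a∈q → P≢Q (trans (sym place-p) (trans
                             (cong place (trans (sym (x∈⁅y⁆⇒x≡y p a∈p)) (x∈⁅y⁆⇒x≡y q a∈q))) place-q)))
                          (cong₂ _+_ (∣⁅x⁆∣≡1 p) (∣⁅x⁆∣≡1 q))))
                 (+-comm m 2))
      where
      off : ∀ r {R a} → place r ≡ R → proj₂ R ≢ ℓ (proj₁ R) → a ∈ base → a ∉ ⁅ r ⁆
      off r eq R∉ a∈ a∈r = off-base eq R∉ (subst (_∈ base) (x∈⁅y⁆⇒x≡y r a∈r) a∈)

    ∈-S : ∀ {a} → a ∈ S → A (place a)
    ∈-S {a} a∈ with x∈p∪q⁻ base _ a∈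
    ... | inj₁ a∈base = subst (λ i → A (proj₁ (place a) , i)) (sym (∈-base a∈base)) (Aℓ _)
    ... | inj₂ a∈pq with x∈p∪q⁻ ⁅ p ⁆ ⁅ q ⁆ a∈pq
    ...   | inj₁ a∈p = subst A (trans (sym place-p) (cong place (sym (x∈⁅y⁆⇒x≡y p a∈p)))) AP
    ...   | inj₂ a∈q = subst A (trans (sym place-q) (cong place (sym (x∈⁅y⁆⇒x≡y q a∈q)))) AQ

    breaks : ∀ {E F} → (∀ {R R′} → A R → A R′ → Adj R R′ → (R ≡ E × R′ ≡ F) ⊎ (R ≡ F × R′ ≡ E)) → Breaks E F
    breaks only refl refl (_ , no-independent) = no-independent (S , size , λ a∈ b∈ (a~b , ¬same) →
      ¬same (Sum.map (Product.map place-injective place-injective) (Product.map place-injective place-injective)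
                     (only (∈-S a∈) (∈-S b∈) a~b)))

  breaks-sym : ∀ {P Q} → Breaks P Q → Breaks Q P
  breaks-sym br {e} {f} eq eq′ g = br eq′ eq
    (ramseyGood-resp {G = deleteEdge G e f} {deleteEdge G f e}
      (Product.map₂ (_∘ Sum.swap) , Product.map₂ (_∘ Sum.swap)) g)

  -- An edge at `Mid` would need a loop or an arc opposite to the one at `v`. Edges between `Out`
  -- and `In` stay in one column, and only `v` has a place in both.
  matched-breaks : ∀ v i → Breaks (v , i) (v , next (next i))
  matched-breaks v i = breaks only
    where
    Out Mid In A : Place → Set
    Out (x , j) = (x ≡ v ⊎ v ⟶ x) × j ≡ i
    Mid (x , j) = x ≡ v × j ≡ next i
    In  (x , j) = (x ≡ v ⊎ x ⟶ v) × j ≡ next (next i)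
    A P = Out P ⊎ Mid P ⊎ In P

    layer : ∀ {x} → Dec (x ≡ v) → Dec (v ⟶ x) → Fin 5
    layer (yes _) _       = next i
    layer (no  _) (yes _) = i
    layer (no  _) (no  _) = next (next i)

    ℓ : Fin m → Fin 5
    ℓ x = layer (x Fin.≟ v) (v ⟶? x)

    ℓ-v : ℓ v ≡ next i
    ℓ-v with v Fin.≟ v
    ... | yes _   = refl
    ... | no  v≢v = contradiction refl v≢v

    Aℓ : ∀ x → A (x , ℓ x)
    Aℓ x with x Fin.≟ v | v ⟶? x
    ... | yes x≡v | _        = inj₂ (inj₁ (x≡v , refl))
    ... | no  x≢v | yes v⟶x = inj₁ (inj₂ v⟶x , refl)
    ... | no  x≢v | no ¬v⟶x =
      inj₂ (inj₂ (inj₂ (Sum.fromInj₁ (λ v⟶x → contradiction v⟶x ¬v⟶x) (⟶-total x≢v)) , refl))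

    -- Column `v` is used three times: `ℓ` takes the middle layer, and the ends of the edge are the
    -- two further places.
    open Breaking A ℓ (v , i) (v , next (next i))
      (λ i≡ → step-irrefl i (trans i≡ ℓ-v))
      (λ i≡ → step-irrefl (next i) (sym (trans i≡ ℓ-v)))
      (λ eq → match-irrefl i (inj₁ (cong proj₂ eq)))
      Aℓ (inj₁ (inj₁ refl , refl)) (inj₂ (inj₂ (inj₁ refl , refl)))

    Edge : Place → Place → Set
    Edge P Q = P ≡ (v , i) × Q ≡ (v , next (next i))

    out-mid : ∀ {P Q} → Out P → Mid Q → ¬ Adj P Q
    out-mid (inj₁ refl , refl) (refl , refl) adj = ⟶-irrefl (adj-step refl adj)
    out-mid (inj₂ v⟶x , refl) (refl , refl) adj = ⟶-asym v⟶x (adj-step refl adj)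

    mid-in : ∀ {P Q} → Mid P → In Q → ¬ Adj P Q
    mid-in (refl , refl) (inj₁ refl , refl) adj = ⟶-irrefl (adj-step refl adj)
    mid-in (refl , refl) (inj₂ x⟶v , refl) adj = ⟶-asym x⟶v (adj-step refl adj)

    out-in : ∀ {P Q} → Out P → In Q → Adj P Q → Edge P Q
    out-in (a , refl) (b , refl) adj with refl ← adj-match (inj₁ refl) adj with a | b
    ... | inj₁ refl | _         = refl , refl
    ... | inj₂ _    | inj₁ refl = refl , refl
    ... | inj₂ v⟶x | inj₂ x⟶v = contradiction x⟶v (⟶-asym v⟶x)

    only : ∀ {P Q} → A P → A Q → Adj P Q → Edge P Q ⊎ (P ≡ (v , next (next i)) × Q ≡ (v , i))
    only (inj₁ (_ , refl))        (inj₁ (_ , refl))        adj = contradiction adj adj-same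
    only (inj₂ (inj₁ (_ , refl))) (inj₂ (inj₁ (_ , refl))) adj = contradiction adj adj-same
    only (inj₂ (inj₂ (_ , refl))) (inj₂ (inj₂ (_ , refl))) adj = contradiction adj adj-same
    only (inj₁ o)                 (inj₂ (inj₁ n))          adj = contradiction adj (out-mid o n)
    only {P} {Q} (inj₂ (inj₁ n))  (inj₁ o)                 adj = contradiction (adj-sym {P} {Q} adj) (out-mid o n)
    only (inj₂ (inj₁ n))          (inj₂ (inj₂ k))          adj = contradiction adj (mid-in n k)
    only {P} {Q} (inj₂ (inj₂ k))  (inj₂ (inj₁ n))          adj = contradiction (adj-sym {P} {Q} adj) (mid-in n k)
    only (inj₁ o)                 (inj₂ (inj₂ k))          adj = inj₁ (out-in o k adj)
    only {P} {Q} (inj₂ (inj₂ k))  (inj₁ o)                 adj = inj₂ (Product.swap (out-in o k (adj-sym {P} {Q} adj)))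

  -- Layer `i + 3` is two away from both `i` and `i + 1`, so an edge to `Rest` would stay in a
  -- column, but `Rest` avoids the columns of `v` and `w`. Between `Tail` and `Head` only the arc
  -- `v ⟶ w` counts.
  arc-breaks : ∀ v w i → v ⟶ w → Breaks (v , i) (w , next i)
  arc-breaks v w i v⟶w = breaks only
    where
    Ends : Fin m → Set
    Ends x = x ≡ v ⊎ x ≡ w

    Tail Head Rest A : Place → Set
    Tail (x , j) = Ends x × j ≡ i
    Head (x , j) = Ends x × j ≡ next i
    Rest (x , j) = ¬ Ends x × j ≡ next (next (next i))
    A P = Tail P ⊎ Head P ⊎ Rest P

    layer : ∀ {x} → Dec (x ≡ v) → Dec (x ≡ w) → Fin 5
    layer (yes _) _       = i
    layer (no  _) (yes _) = next i
    layer (no  _) (no  _) = next (next (next i))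

    ℓ : Fin m → Fin 5
    ℓ x = layer (x Fin.≟ v) (x Fin.≟ w)

    ℓ-v : ℓ v ≡ i
    ℓ-v with v Fin.≟ v
    ... | yes _   = refl
    ... | no  v≢v = contradiction refl v≢v

    ℓ-w : ℓ w ≡ next i
    ℓ-w with w Fin.≟ v | w Fin.≟ w
    ... | yes refl | _       = contradiction v⟶w ⟶-irrefl
    ... | no  _    | yes _   = refl
    ... | no  _    | no  w≢w = contradiction refl w≢w

    Aℓ : ∀ x → A (x , ℓ x)
    Aℓ x with x Fin.≟ v | x Fin.≟ w
    ... | yes x≡v | _       = inj₁ (inj₁ x≡v , refl)
    ... | no  _   | yes x≡w = inj₂ (inj₁ (inj₂ x≡w , refl))
    ... | no  x≢v | no  x≢w = inj₂ (inj₂ (Sum.[ x≢v , x≢w ] , refl))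

    -- `ℓ` takes the ends of the edge; the two further places are the crossed pair.
    open Breaking A ℓ (w , i) (v , next i)
      (λ i≡ → step-irrefl i (trans i≡ ℓ-w))
      (λ ≡i → step-irrefl i (sym (trans ≡i ℓ-v)))
      (λ eq → step-irrefl i (cong proj₂ eq))
      Aℓ (inj₁ (inj₂ refl , refl)) (inj₂ (inj₁ (inj₁ refl , refl)))

    Edge : Place → Place → Set
    Edge P Q = P ≡ (v , i) × Q ≡ (w , next i)

    tail-head : ∀ {P Q} → Tail P → Head Q → Adj P Q → Edge P Q
    tail-head (inj₁ refl , refl) (inj₂ refl , refl) adj = refl , refl
    tail-head (inj₁ refl , refl) (inj₁ refl , refl) adj = contradiction (adj-step refl adj) ⟶-irrefl
    tail-head (inj₂ refl , refl) (inj₂ refl , refl) adj = contradiction (adj-step refl adj) ⟶-irrefl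
    tail-head (inj₂ refl , refl) (inj₁ refl , refl) adj = contradiction (adj-step refl adj) (⟶-asym v⟶w)

    tail-rest : ∀ {P Q} → Tail P → Rest Q → ¬ Adj P Q
    tail-rest (end , refl) (¬end , refl) adj = ¬end (subst Ends (adj-match (inj₂ (sym (next⁵ i))) adj) end)

    head-rest : ∀ {P Q} → Head P → Rest Q → ¬ Adj P Q
    head-rest (end , refl) (¬end , refl) adj = ¬end (subst Ends (adj-match (inj₁ refl) adj) end)

    only : ∀ {P Q} → A P → A Q → Adj P Q → Edge P Q ⊎ (P ≡ (w , next i) × Q ≡ (v , i))
    only (inj₁ (_ , refl))        (inj₁ (_ , refl))        adj = contradiction adj adj-same
    only (inj₂ (inj₁ (_ , refl))) (inj₂ (inj₁ (_ , refl))) adj = contradiction adj adj-same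
    only (inj₂ (inj₂ (_ , refl))) (inj₂ (inj₂ (_ , refl))) adj = contradiction adj adj-same
    only (inj₁ t)                 (inj₂ (inj₁ h))          adj = inj₁ (tail-head t h adj)
    only {P} {Q} (inj₂ (inj₁ h))  (inj₁ t)                 adj = inj₂ (Product.swap (tail-head t h (adj-sym {P} {Q} adj)))
    only (inj₁ t)                 (inj₂ (inj₂ r))          adj = contradiction adj (tail-rest t r)
    only {P} {Q} (inj₂ (inj₂ r))  (inj₁ t)                 adj = contradiction (adj-sym {P} {Q} adj) (tail-rest t r)
    only (inj₂ (inj₁ h))          (inj₂ (inj₂ r))          adj = contradiction adj (head-rest h r)
    only {P} {Q} (inj₂ (inj₂ r))  (inj₂ (inj₁ h))          adj = contradiction (adj-sym {P} {Q} adj) (head-rest h r)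

  del-breaks : ∀ {u v} → u ~ v → ¬ RamseyGood 3 (2 + m) (deleteEdge G u v)
  del-breaks {u} {v} u~v = go (place u) (place v) u~v refl refl
    where
    go : ∀ P Q → Adj P Q → Breaks P Q
    go (x , i) (.x , _) (inj₁ (refl , inj₁ refl))     = matched-breaks x i
    go (x , _) (.x , j) (inj₁ (refl , inj₂ refl))     = breaks-sym (matched-breaks x j)
    go (x , i) (y , _)  (inj₂ (inj₁ (x⟶y , refl))) = arc-breaks x y i x⟶y
    go (x , _) (y , j)  (inj₂ (inj₂ (y⟶x , refl))) = breaks-sym (arc-breaks y x j y⟶x)

  saturated : DoublySaturated 3 (2 + m) G
  saturated = record
    { good       = triangle-free ∘ clique⇒triangle G , no-large-independent
    ; add-breaks = add-breaks
    ; del-breaks = del-breaks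
    }

-- Combining the bounds

odd-≥17 : ∀ t → t % 2 ≡ 1 → 17 ≤ t → ∃ λ k → t ≡ 17 + (k + k)
odd-≥17 t odd 17≤t =
  let k , t∸17≡2k = halve (t ∸ 17) (trans (cong (_% 2) (m+[n∸m]≡n 17≤t)) odd)
  in k , trans (sym (m+[n∸m]≡n 17≤t)) (cong (17 +_) t∸17≡2k)
  where
  halve : ∀ d → suc d % 2 ≡ 1 → ∃ λ k → d ≡ k + k
  halve 0             _   = 0 , refl
  halve (suc (suc d)) odd =
    let k , d≡2k = halve d odd in suc k , trans (cong (2 +_) d≡2k) (cong suc (sym (+-suc k k)))

corollary7p1 : ∀ (t : ℕ) → t % 2 ≡ 1 → 17 ≤ t →
    ∃ λ d → IsDS 3 t d × (2 * t ∸ 1 ≤ d) × (d ≤ 5 * t ∸ 10)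
corollary7p1 t odd 17≤t = from (odd-≥17 t odd 17≤t)
  where
  from : (∃ λ k → t ≡ 17 + (k + k)) → ∃ λ d → IsDS 3 t d × (2 * t ∸ 1 ≤ d) × (d ≤ 5 * t ∸ 10)
  from (k , refl) =
    -- With `m = t ∸ 2` columns of five places the order is `5 * t ∸ 10`. The lower bound is applied
    -- to the minimal graph `H`.
    let open Construction (15 + (k + k)) (m≤m+n 15 (k + k)) (weight-bound k)
        d , isDS@((2≤d , H , saturatedH) , _) , d≤ =
          least (hasDoublySaturated? 3 t) ((15 + (k + k)) * 5) (m≤m+n 2 _ , G , saturated)
    in d , isDS
         , LowerBound.lower-bound H saturatedH 2≤d (≤-trans (m≤m+n 3 14) 17≤t)
         , ≤-trans d≤ (≤-reflexive (sym (cong (_∸ 10) (*-comm 5 t))))
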